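{- Let $i, n$ be positive integers with $i\leq n$ and $n\geq 2$, let $t_{1},\ldots,t_{n-2}$ be independent variables, and let $\mathbb{Q}(t_{1},\ldots,t_{n-2})$ be the field of rational functions in these variables (equal to $\mathbb{Q}$ if $n=2$). Then the set of those $a\in\mathbb{Q}(t_{1},\ldots,t_{n-2})\setminus\{0\}$ for which the system of equations $$\sigma_{i}(x_{1},\ldots,x_{2n})=a,\quad \sigma_{2n-i}(x_{1},\ldots,x_{2n})=a,\quad \sigma_{2n}(x_{1},\ldots,x_{2n})=1$$ has infinitely many solutions $(x_{1},\ldots,x_{2n})$ with all $x_{j}\in\mathbb{Q}(t_{1},\ldots,t_{n-2})$ is infinite.
   Context: $\sigma_{k}(x_{1},\ldots,x_{m})=\sum_{1\le j_{1}<\cdots<j_{k}\le m}x_{j_{1}}\cdots x_{j_{k}}$ denotes the $k$-th elementary symmetric polynomial in $m$ variables. -}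

module Defs where

open import Level using (0ℓ; _⊔_)
open import Algebra.Bundles using (CommutativeRing)
open import Algebra.Apartness.Bundles using (HeytingField)
import Algebra.Properties.Ring as RingProperties
import Algebra.Solver.Ring.NaturalCoefficients.Default as NatSolver
open import Data.Empty using (⊥-elim)
open import Data.List.Base using (List; []; _∷_; _++_; map; foldr; allFin)
import Data.List.Membership.Setoid as Membership
open import Data.Nat.Base using (ℕ; zero; suc)
open import Data.Product.Base using (_×_; _,_; ∃-syntax)
open import Data.Rational.Base using (ℚ)
import Data.Rational.Properties as ℚ
open import Data.Sum.Base as Sum using (_⊎_; inj₁; inj₂)
open import Data.Vec.Functional using (Vector)
open import Relation.Binary.Bundles using (Setoid; DecSetoid)
open import Relation.Binary.Definitions using (Decidable)
open import Relation.Binary.Structures using (IsEquivalence)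
import Relation.Binary.Properties.DecSetoid as DecSetoidProperties
import Relation.Binary.Reasoning.Setoid as SetoidReasoning
open import Relation.Nullary.Decidable.Core using (Dec; yes; no; map′; _×-dec_)
open import Relation.Nullary.Negation.Core using (¬_)
open import Relation.Unary using (Pred)

-- A subset is infinite when no finite list exhausts it, in the positive form
-- that produces a member outside any given list.
Infinite : ∀ {c ℓ p} (S : Setoid c ℓ) → Pred (Setoid.Carrier S) p → Set (c ⊔ ℓ ⊔ p)
Infinite S P = ∀ xs → ∃[ x ] (P x × x ∉ xs)
  where open Membership S using (_∉_)

-- The subsequences of length k, one for each choice of k positions.  Applied to
-- allFin m it lists exactly the sequences j₁ < ⋯ < j_k in Fin m, each once.
choose : ∀ {a} {A : Set a} → ℕ → List A → List (List A)
choose zero    xs       = [] ∷ []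
choose (suc k) []       = []
choose (suc k) (x ∷ xs) = map (x ∷_) (choose k xs) ++ choose (suc k) xs

module ElementarySymmetric {c ℓ} (R : CommutativeRing c ℓ) where
  open CommutativeRing R

  σ : ∀ {m} → ℕ → Vector Carrier m → Carrier
  σ {m} k x =
    foldr _+_ 0# (map (λ js → foldr _*_ 1# (map x js)) (choose k (allFin m)))

record IntegralDomain : Set₁ where
  infix 4 _≟_
  field
    commutativeRing : CommutativeRing 0ℓ 0ℓ
  open CommutativeRing commutativeRing public
  field
    _≟_            : Decidable _≈_
    1≉0            : 1# ≉ 0#
    noZeroDivisors : ∀ {x y} → x * y ≈ 0# → x ≈ 0# ⊎ y ≈ 0#

  open RingProperties ring public
    using (-0#≈0#; -‿distribˡ-*; x∙y⁻¹≈ε⇒x≈y; x≈y⇒x∙y⁻¹≈ε)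

  *-cancelʳ-≉0 : ∀ {x y z} → z ≉ 0# → x * z ≈ y * z → x ≈ y
  *-cancelʳ-≉0 {x} {y} {z} z≉0 xz≈yz with noZeroDivisors [x-y]z≈0
    where
    open SetoidReasoning setoid
    [x-y]z≈0 : (x - y) * z ≈ 0#
    [x-y]z≈0 = begin
      (x - y) * z       ≈⟨ distribʳ z x (- y) ⟩
      x * z + - y * z   ≈⟨ +-congˡ (-‿distribˡ-* y z) ⟨
      x * z - y * z     ≈⟨ x≈y⇒x∙y⁻¹≈ε xz≈yz ⟩
      0#                ∎
  ... | inj₁ x-y≈0 = x∙y⁻¹≈ε⇒x≈y x y x-y≈0
  ... | inj₂ z≈0   = ⊥-elim (z≉0 z≈0)

  *-≉0 : ∀ {x y} → x ≉ 0# → y ≉ 0# → x * y ≉ 0#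
  *-≉0 x≉0 y≉0 xy≈0 with noZeroDivisors xy≈0
  ... | inj₁ x≈0 = x≉0 x≈0
  ... | inj₂ y≈0 = y≉0 y≈0

-- Univariate polynomials, as coefficient lists in increasing degree; trailing
-- zeros are allowed, and two lists are equal when all their coefficients agree.
module Polynomial (D : IntegralDomain) where
  private
    module D = IntegralDomain D
    open SetoidReasoning D.setoid

  Poly : Set
  Poly = List D.Carrier

  coeff : Poly → ℕ → D.Carrier
  coeff []      n       = D.0#
  coeff (a ∷ p) zero    = a
  coeff (a ∷ p) (suc n) = coeff p n

  infix 4 _≈_
  record _≈_ (p q : Poly) : Set where
    constructor mk≈
    field at : ∀ n → coeff p n D.≈ coeff q n
  open _≈_

  infixl 6 _+_
  infixl 7 _*_ _·_
  infix  8 -_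

  _+_ : Poly → Poly → Poly
  []      + q       = q
  (a ∷ p) + []      = a ∷ p
  (a ∷ p) + (b ∷ q) = (a D.+ b) ∷ (p + q)

  -_ : Poly → Poly
  -_ = map (D.-_)

  _·_ : D.Carrier → Poly → Poly
  a · p = map (a D.*_) p

  _*_ : Poly → Poly → Poly
  []      * q = []
  (a ∷ p) * q = a · q + (D.0# ∷ p * q)

  0ₚ 1ₚ : Poly
  0ₚ = []
  1ₚ = D.1# ∷ []

  private
    ≈-refl : ∀ {p} → p ≈ p
    ≈-refl = mk≈ λ n → D.refl

    ≈-sym : ∀ {p q} → p ≈ q → q ≈ p
    ≈-sym e = mk≈ λ n → D.sym (at e n)

    ≈-trans : ∀ {p q r} → p ≈ q → q ≈ r → p ≈ r
    ≈-trans e f = mk≈ λ n → D.trans (at e n) (at f n)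

    ≈-isEquivalence : IsEquivalence _≈_
    ≈-isEquivalence = record { refl = ≈-refl ; sym = ≈-sym ; trans = ≈-trans }

    ≈-setoid : Setoid 0ℓ 0ℓ
    ≈-setoid = record { isEquivalence = ≈-isEquivalence }

    module P = SetoidReasoning ≈-setoid

    ∷-cong : ∀ {a b p q} → a D.≈ b → p ≈ q → (a ∷ p) ≈ (b ∷ q)
    ∷-cong a≈b p≈q = mk≈ λ { zero → a≈b ; (suc n) → at p≈q n }

    tail-≈ : ∀ {a b p q} → (a ∷ p) ≈ (b ∷ q) → p ≈ q
    tail-≈ e = mk≈ λ n → at e (suc n)

    tail-≈0 : ∀ {a p} → (a ∷ p) ≈ [] → p ≈ []
    tail-≈0 e = mk≈ λ n → at e (suc n)

    ∷-≈0 : ∀ {a p} → a D.≈ D.0# → p ≈ [] → (a ∷ p) ≈ []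
    ∷-≈0 a≈0 p≈0 = mk≈ λ { zero → a≈0 ; (suc n) → at p≈0 n }

    coeff-+ : ∀ p q n → coeff (p + q) n D.≈ coeff p n D.+ coeff q n
    coeff-+ []      q       n       = D.sym (D.+-identityˡ _)
    coeff-+ (a ∷ p) []      n       = D.sym (D.+-identityʳ _)
    coeff-+ (a ∷ p) (b ∷ q) zero    = D.refl
    coeff-+ (a ∷ p) (b ∷ q) (suc n) = coeff-+ p q n

    coeff-neg : ∀ p n → coeff (- p) n D.≈ D.- coeff p n
    coeff-neg []      n       = D.sym D.-0#≈0#
    coeff-neg (a ∷ p) zero    = D.refl
    coeff-neg (a ∷ p) (suc n) = coeff-neg p n

    coeff-· : ∀ a p n → coeff (a · p) n D.≈ a D.* coeff p n
    coeff-· a []      n       = D.sym (D.zeroʳ a)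
    coeff-· a (b ∷ p) zero    = D.refl
    coeff-· a (b ∷ p) (suc n) = coeff-· a p n

    +-cong : ∀ {p p′ q q′} → p ≈ p′ → q ≈ q′ → (p + q) ≈ (p′ + q′)
    +-cong {p} {p′} {q} {q′} e f = mk≈ λ n → begin
      coeff (p + q) n            ≈⟨ coeff-+ p q n ⟩
      coeff p n D.+ coeff q n    ≈⟨ D.+-cong (at e n) (at f n) ⟩
      coeff p′ n D.+ coeff q′ n  ≈⟨ coeff-+ p′ q′ n ⟨
      coeff (p′ + q′) n          ∎

    +-assoc : ∀ p q r → ((p + q) + r) ≈ (p + (q + r))
    +-assoc p q r = mk≈ λ n → begin
      coeff (p + q + r) n                        ≈⟨ coeff-+ (p + q) r n ⟩
      coeff (p + q) n D.+ coeff r n              ≈⟨ D.+-congʳ (coeff-+ p q n) ⟩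
      coeff p n D.+ coeff q n D.+ coeff r n      ≈⟨ D.+-assoc _ _ _ ⟩
      coeff p n D.+ (coeff q n D.+ coeff r n)    ≈⟨ D.+-congˡ (coeff-+ q r n) ⟨
      coeff p n D.+ coeff (q + r) n              ≈⟨ coeff-+ p (q + r) n ⟨
      coeff (p + (q + r)) n                      ∎

    +-comm : ∀ p q → (p + q) ≈ (q + p)
    +-comm p q = mk≈ λ n → begin
      coeff (p + q) n          ≈⟨ coeff-+ p q n ⟩
      coeff p n D.+ coeff q n  ≈⟨ D.+-comm _ _ ⟩
      coeff q n D.+ coeff p n  ≈⟨ coeff-+ q p n ⟨
      coeff (q + p) n          ∎

    +-identityʳ : ∀ p → (p + 0ₚ) ≈ p
    +-identityʳ p = +-comm p 0ₚ

    -‿inverseʳ : ∀ p → (p + - p) ≈ 0ₚ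
    -‿inverseʳ p = mk≈ λ n → begin
      coeff (p + - p) n              ≈⟨ coeff-+ p (- p) n ⟩
      coeff p n D.+ coeff (- p) n    ≈⟨ D.+-congˡ (coeff-neg p n) ⟩
      coeff p n D.- coeff p n        ≈⟨ D.-‿inverseʳ _ ⟩
      D.0#                           ∎

    -‿cong : ∀ {p q} → p ≈ q → (- p) ≈ (- q)
    -‿cong {p} {q} e = mk≈ λ n → begin
      coeff (- p) n   ≈⟨ coeff-neg p n ⟩
      D.- coeff p n   ≈⟨ D.-‿cong (at e n) ⟩
      D.- coeff q n   ≈⟨ coeff-neg q n ⟨
      coeff (- q) n   ∎

    +-interchange : ∀ p q r s → ((p + q) + (r + s)) ≈ ((p + r) + (q + s))
    +-interchange p q r s = P.begin
      (p + q) + (r + s)  P.≈⟨ +-assoc p q (r + s) ⟩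
      p + (q + (r + s))  P.≈⟨ +-cong (≈-refl {p}) (+-assoc q r s) ⟨
      p + ((q + r) + s)  P.≈⟨ +-cong (≈-refl {p}) (+-cong (+-comm q r) (≈-refl {s})) ⟩
      p + ((r + q) + s)  P.≈⟨ +-cong (≈-refl {p}) (+-assoc r q s) ⟩
      p + (r + (q + s))  P.≈⟨ +-assoc p r (q + s) ⟨
      (p + r) + (q + s)  P.∎

    ·-cong : ∀ {a b p q} → a D.≈ b → p ≈ q → (a · p) ≈ (b · q)
    ·-cong {a} {b} {p} {q} a≈b e = mk≈ λ n → begin
      coeff (a · p) n    ≈⟨ coeff-· a p n ⟩
      a D.* coeff p n    ≈⟨ D.*-cong a≈b (at e n) ⟩
      b D.* coeff q n    ≈⟨ coeff-· b q n ⟨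
      coeff (b · q) n    ∎

    ·-zeroˡ : ∀ {a} p → a D.≈ D.0# → (a · p) ≈ 0ₚ
    ·-zeroˡ {a} p a≈0 = mk≈ λ n → begin
      coeff (a · p) n       ≈⟨ coeff-· a p n ⟩
      a D.* coeff p n       ≈⟨ D.*-congʳ a≈0 ⟩
      D.0# D.* coeff p n    ≈⟨ D.zeroˡ _ ⟩
      D.0#                  ∎

    ·-distribˡ-+ : ∀ a p q → (a · (p + q)) ≈ (a · p + a · q)
    ·-distribˡ-+ a p q = mk≈ λ n → begin
      coeff (a · (p + q)) n                    ≈⟨ coeff-· a (p + q) n ⟩
      a D.* coeff (p + q) n                    ≈⟨ D.*-congˡ (coeff-+ p q n) ⟩
      a D.* (coeff p n D.+ coeff q n)          ≈⟨ D.distribˡ a _ _ ⟩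
      a D.* coeff p n D.+ a D.* coeff q n      ≈⟨ D.+-cong (coeff-· a p n) (coeff-· a q n) ⟨
      coeff (a · p) n D.+ coeff (a · q) n      ≈⟨ coeff-+ (a · p) (a · q) n ⟨
      coeff (a · p + a · q) n                  ∎

    ·-distribʳ-+ : ∀ a b p → ((a D.+ b) · p) ≈ (a · p + b · p)
    ·-distribʳ-+ a b p = mk≈ λ n → begin
      coeff ((a D.+ b) · p) n                  ≈⟨ coeff-· (a D.+ b) p n ⟩
      (a D.+ b) D.* coeff p n                  ≈⟨ D.distribʳ _ a b ⟩
      a D.* coeff p n D.+ b D.* coeff p n      ≈⟨ D.+-cong (coeff-· a p n) (coeff-· b p n) ⟨
      coeff (a · p) n D.+ coeff (b · p) n      ≈⟨ coeff-+ (a · p) (b · p) n ⟨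
      coeff (a · p + b · p) n                  ∎

    ·-assoc : ∀ a b p → ((a D.* b) · p) ≈ (a · (b · p))
    ·-assoc a b p = mk≈ λ n → begin
      coeff ((a D.* b) · p) n      ≈⟨ coeff-· (a D.* b) p n ⟩
      a D.* b D.* coeff p n        ≈⟨ D.*-assoc a b _ ⟩
      a D.* (b D.* coeff p n)      ≈⟨ D.*-congˡ (coeff-· b p n) ⟨
      a D.* coeff (b · p) n        ≈⟨ coeff-· a (b · p) n ⟨
      coeff (a · (b · p)) n        ∎

    ·-identity : ∀ p → (D.1# · p) ≈ p
    ·-identity p = mk≈ λ n → D.trans (coeff-· D.1# p n) (D.*-identityˡ _)

    0∷-+ : ∀ p q → (D.0# ∷ p + q) ≈ ((D.0# ∷ p) + (D.0# ∷ q))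
    0∷-+ p q = ∷-cong (D.sym (D.+-identityˡ D.0#)) ≈-refl

    *-congˡ : ∀ p {q r} → q ≈ r → (p * q) ≈ (p * r)
    *-congˡ []      e = ≈-refl
    *-congˡ (a ∷ p) e = +-cong (·-cong D.refl e) (∷-cong D.refl (*-congˡ p e))

    *-zeroʳ : ∀ p → (p * 0ₚ) ≈ 0ₚ
    *-zeroʳ []      = ≈-refl
    *-zeroʳ (a ∷ p) = ∷-≈0 D.refl (*-zeroʳ p)

    *-zeroˡ : ∀ {p} q → p ≈ 0ₚ → (p * q) ≈ 0ₚ
    *-zeroˡ {[]}    q e = ≈-refl
    *-zeroˡ {a ∷ p} q e =
      +-cong (·-zeroˡ q (at e 0)) (∷-≈0 D.refl (*-zeroˡ q (tail-≈0 e)))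

    -- p * (b ∷ q) unfolded on its second argument
    *-∷ʳ : ∀ p b q → (p * (b ∷ q)) ≈ (b · p + (D.0# ∷ p * q))
    *-∷ʳ []      b q = ≈-sym (∷-≈0 D.refl ≈-refl)
    *-∷ʳ (a ∷ p) b q = ∷-cong (D.+-congʳ (D.*-comm a b)) (P.begin
      a · q + p * (b ∷ q)                 P.≈⟨ +-cong ≈-refl (*-∷ʳ p b q) ⟩
      a · q + (b · p + (D.0# ∷ p * q))    P.≈⟨ +-assoc (a · q) (b · p) (D.0# ∷ p * q) ⟨
      (a · q + b · p) + (D.0# ∷ p * q)    P.≈⟨ +-cong (+-comm (a · q) (b · p)) ≈-refl ⟩
      (b · p + a · q) + (D.0# ∷ p * q)    P.≈⟨ +-assoc (b · p) (a · q) (D.0# ∷ p * q) ⟩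
      b · p + (a ∷ p) * q                 P.∎)

    *-comm : ∀ p q → (p * q) ≈ (q * p)
    *-comm []      q = ≈-sym (*-zeroʳ q)
    *-comm (a ∷ p) q = ≈-trans
      (+-cong ≈-refl (∷-cong D.refl (*-comm p q))) (≈-sym (*-∷ʳ q a p))

    *-cong : ∀ {p p′ q q′} → p ≈ p′ → q ≈ q′ → (p * q) ≈ (p′ * q′)
    *-cong {p} {p′} {q} {q′} e f = P.begin
      p * q     P.≈⟨ *-congˡ p f ⟩
      p * q′    P.≈⟨ *-comm p q′ ⟩
      q′ * p    P.≈⟨ *-congˡ q′ e ⟩
      q′ * p′   P.≈⟨ *-comm q′ p′ ⟩
      p′ * q′   P.∎

    *-distribˡ-+ : ∀ p q r → (p * (q + r)) ≈ (p * q + p * r)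
    *-distribˡ-+ []      q r = ≈-refl
    *-distribˡ-+ (a ∷ p) q r = P.begin
      a · (q + r) + (D.0# ∷ p * (q + r))
        P.≈⟨ +-cong (·-distribˡ-+ a q r)
               (≈-trans (∷-cong D.refl (*-distribˡ-+ p q r)) (0∷-+ (p * q) (p * r))) ⟩
      (a · q + a · r) + ((D.0# ∷ p * q) + (D.0# ∷ p * r))
        P.≈⟨ +-interchange (a · q) (a · r) (D.0# ∷ p * q) (D.0# ∷ p * r) ⟩
      (a ∷ p) * q + (a ∷ p) * r P.∎

    *-distribʳ-+ : ∀ p q r → ((q + r) * p) ≈ (q * p + r * p)
    *-distribʳ-+ p q r = P.begin
      (q + r) * p    P.≈⟨ *-comm (q + r) p ⟩
      p * (q + r)    P.≈⟨ *-distribˡ-+ p q r ⟩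
      p * q + p * r  P.≈⟨ +-cong (*-comm p q) (*-comm p r) ⟩
      q * p + r * p  P.∎

    ·-*-assoc : ∀ a p q → ((a · p) * q) ≈ (a · (p * q))
    ·-*-assoc a []      q = ≈-refl
    ·-*-assoc a (b ∷ p) q = P.begin
      (a D.* b) · q + (D.0# ∷ (a · p) * q)
        P.≈⟨ +-cong (·-assoc a b q) (∷-cong (D.sym (D.zeroʳ a)) (·-*-assoc a p q)) ⟩
      a · (b · q) + a · (D.0# ∷ p * q)
        P.≈⟨ ·-distribˡ-+ a (b · q) (D.0# ∷ p * q) ⟨
      a · ((b ∷ p) * q) P.∎

    *-assoc : ∀ p q r → ((p * q) * r) ≈ (p * (q * r))
    *-assoc []      q r = ≈-refl
    *-assoc (a ∷ p) q r = P.begin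
      (a · q + (D.0# ∷ p * q)) * r
        P.≈⟨ *-distribʳ-+ r (a · q) (D.0# ∷ p * q) ⟩
      (a · q) * r + (D.0# · r + (D.0# ∷ (p * q) * r))
        P.≈⟨ +-cong (·-*-assoc a q r)
               (+-cong (·-zeroˡ r D.refl) (∷-cong D.refl (*-assoc p q r))) ⟩
      (a ∷ p) * (q * r) P.∎

    *-identityˡ : ∀ p → (1ₚ * p) ≈ p
    *-identityˡ p = P.begin
      D.1# · p + (D.0# ∷ [])  P.≈⟨ +-cong (·-identity p) (∷-≈0 D.refl ≈-refl) ⟩
      p + []                  P.≈⟨ +-identityʳ p ⟩
      p                       P.∎

    ≟0 : ∀ p → Dec (p ≈ [])
    ≟0 []      = yes ≈-refl
    ≟0 (a ∷ p) = map′ (λ (e , f) → ∷-≈0 e f) (λ e → at e 0 , tail-≈0 e)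
                      ((a D.≟ D.0#) ×-dec ≟0 p)

    _≟_ : Decidable _≈_
    []      ≟ q       = map′ ≈-sym ≈-sym (≟0 q)
    (a ∷ p) ≟ []      = ≟0 (a ∷ p)
    (a ∷ p) ≟ (b ∷ q) = map′ (λ (e , f) → ∷-cong e f) (λ e → at e 0 , tail-≈ e)
                             ((a D.≟ b) ×-dec (p ≟ q))

    lead≉0 : ∀ {a} p q → a D.≉ D.0# → ((a ∷ p) * q) ≈ 0ₚ → q ≈ 0ₚ
    lead≉0     p []      a≉0 e = ≈-refl
    lead≉0 {a} p (b ∷ q) a≉0 e = ∷-≈0 b≈0 (lead≉0 p q a≉0 (tail-≈0 (P.begin
      D.0# ∷ (a ∷ p) * q                   P.≈⟨ +-cong (·-zeroˡ (a ∷ p) b≈0) (≈-refl {D.0# ∷ (a ∷ p) * q}) ⟨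
      b · (a ∷ p) + (D.0# ∷ (a ∷ p) * q)   P.≈⟨ *-∷ʳ (a ∷ p) b q ⟨
      (a ∷ p) * (b ∷ q)                    P.≈⟨ e ⟩
      0ₚ                                   P.∎)))
      where
      b≈0 : b D.≈ D.0#
      b≈0 with D.noZeroDivisors (D.trans (D.sym (D.+-identityʳ _)) (at e 0))
      ... | inj₁ a≈0 = ⊥-elim (a≉0 a≈0)
      ... | inj₂ b≈0 = b≈0

    noZeroDivisors : ∀ p q → (p * q) ≈ 0ₚ → p ≈ 0ₚ ⊎ q ≈ 0ₚ
    noZeroDivisors []      q e = inj₁ ≈-refl
    noZeroDivisors (a ∷ p) q e with a D.≟ D.0#
    ... | no a≉0  = inj₂ (lead≉0 p q a≉0 e)
    ... | yes a≈0 = Sum.map₁ (∷-≈0 a≈0) (noZeroDivisors p q (tail-≈0 (P.begin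
      D.0# ∷ p * q   P.≈⟨ +-cong (·-zeroˡ q a≈0) (≈-refl {D.0# ∷ p * q}) ⟨
      (a ∷ p) * q    P.≈⟨ e ⟩
      0ₚ             P.∎)))

  commutativeRing : CommutativeRing 0ℓ 0ℓ
  commutativeRing = record
    { Carrier = Poly ; _≈_ = _≈_ ; _+_ = _+_ ; _*_ = _*_ ; -_ = -_ ; 0# = 0ₚ ; 1# = 1ₚ
    ; isCommutativeRing = record
      { isRing = record
        { +-isAbelianGroup = record
          { isGroup = record
            { isMonoid = record
              { isSemigroup = record
                { isMagma = record { isEquivalence = ≈-isEquivalence ; ∙-cong = +-cong }
                ; assoc = +-assoc }
              ; identity = (λ p → ≈-refl) , +-identityʳ }
            ; inverse = (λ p → ≈-trans (+-comm (- p) p) (-‿inverseʳ p)) , -‿inverseʳ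
            ; ⁻¹-cong = -‿cong }
          ; comm = +-comm }
        ; *-cong = *-cong
        ; *-assoc = *-assoc
        ; *-identity = *-identityˡ , λ p → ≈-trans (*-comm p 1ₚ) (*-identityˡ p)
        ; distrib = *-distribˡ-+ , *-distribʳ-+ }
      ; *-comm = *-comm }
    }

  integralDomain : IntegralDomain
  integralDomain = record
    { commutativeRing = commutativeRing
    ; _≟_             = _≟_
    ; 1≉0             = λ e → D.1≉0 (at e 0)
    ; noZeroDivisors  = λ {p} {q} → noZeroDivisors p q
    }

module FractionField (D : IntegralDomain) where
  private
    module D = IntegralDomain D
    open NatSolver D.commutativeSemiring using (solve; _:+_; _:*_; _:=_; con)
    open SetoidReasoning D.setoid

  record Fraction : Set where
    constructor frac
    field
      num   : D.Carrier
      den   : D.Carrier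
      den≉0 : den D.≉ D.0#
  open Fraction

  infix 4 _≈_
  record _≈_ (x y : Fraction) : Set where
    constructor mk≈
    field cross : num x D.* den y D.≈ num y D.* den x
  open _≈_

  infixl 6 _+_
  infixl 7 _*_
  infix  8 -_

  _+_ _*_ : Fraction → Fraction → Fraction
  frac a b b≉0 + frac c d d≉0 = frac (a D.* d D.+ c D.* b) (b D.* d) (D.*-≉0 b≉0 d≉0)
  frac a b b≉0 * frac c d d≉0 = frac (a D.* c) (b D.* d) (D.*-≉0 b≉0 d≉0)

  -_ : Fraction → Fraction
  - frac a b b≉0 = frac (D.- a) b b≉0

  0f 1f : Fraction
  0f = frac D.0# D.1# D.1≉0
  1f = frac D.1# D.1# D.1≉0

  private
    ≈-refl : ∀ {x} → x ≈ x
    ≈-refl = mk≈ D.refl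

    ≈-sym : ∀ {x y} → x ≈ y → y ≈ x
    ≈-sym (mk≈ e) = mk≈ (D.sym e)

    ≈-trans : ∀ {x y z} → x ≈ y → y ≈ z → x ≈ z
    ≈-trans {frac a b _} {frac c d d≉0} {frac e f _} (mk≈ p) (mk≈ q) =
      mk≈ (D.*-cancelʳ-≉0 d≉0 (begin
        a D.* f D.* d    ≈⟨ swap a f d ⟩
        a D.* d D.* f    ≈⟨ D.*-congʳ p ⟩
        c D.* b D.* f    ≈⟨ swap c b f ⟩
        c D.* f D.* b    ≈⟨ D.*-congʳ q ⟩
        e D.* d D.* b    ≈⟨ swap e d b ⟩
        e D.* b D.* d    ∎))
      where
      swap : ∀ x y z → x D.* y D.* z D.≈ x D.* z D.* y
      swap = solve 3 (λ x y z → x :* y :* z := x :* z :* y) D.refl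

    ≈-isEquivalence : IsEquivalence _≈_
    ≈-isEquivalence = record { refl = ≈-refl ; sym = ≈-sym ; trans = ≈-trans }

    +-cong : ∀ {x x′ y y′} → x ≈ x′ → y ≈ y′ → (x + y) ≈ (x′ + y′)
    +-cong {frac a b _} {frac a′ b′ _} {frac c d _} {frac c′ d′ _} (mk≈ p) (mk≈ q) = mk≈ (begin
      (a D.* d D.+ c D.* b) D.* (b′ D.* d′)
        ≈⟨ solve 6 (λ a b c d b′ d′ → (a :* d :+ c :* b) :* (b′ :* d′)
             := (a :* b′) :* (d :* d′) :+ (c :* d′) :* (b :* b′)) D.refl a b c d b′ d′ ⟩
      a D.* b′ D.* (d D.* d′) D.+ c D.* d′ D.* (b D.* b′)
        ≈⟨ D.+-cong (D.*-congʳ p) (D.*-congʳ q) ⟩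
      a′ D.* b D.* (d D.* d′) D.+ c′ D.* d D.* (b D.* b′)
        ≈⟨ solve 6 (λ a′ b c′ d b′ d′ → (a′ :* b) :* (d :* d′) :+ (c′ :* d) :* (b :* b′)
             := (a′ :* d′ :+ c′ :* b′) :* (b :* d)) D.refl a′ b c′ d b′ d′ ⟩
      (a′ D.* d′ D.+ c′ D.* b′) D.* (b D.* d) ∎)

    *-cong : ∀ {x x′ y y′} → x ≈ x′ → y ≈ y′ → (x * y) ≈ (x′ * y′)
    *-cong {frac a b _} {frac a′ b′ _} {frac c d _} {frac c′ d′ _} (mk≈ p) (mk≈ q) = mk≈ (begin
      a D.* c D.* (b′ D.* d′)    ≈⟨ inter a c b′ d′ ⟩
      a D.* b′ D.* (c D.* d′)    ≈⟨ D.*-cong p q ⟩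
      a′ D.* b D.* (c′ D.* d)    ≈⟨ inter a′ b c′ d ⟩
      a′ D.* c′ D.* (b D.* d)    ∎)
      where
      inter : ∀ w x y z → w D.* x D.* (y D.* z) D.≈ w D.* y D.* (x D.* z)
      inter = solve 4 (λ w x y z → w :* x :* (y :* z) := w :* y :* (x :* z)) D.refl

    -‿cong : ∀ {x y} → x ≈ y → (- x) ≈ (- y)
    -‿cong {frac a b _} {frac c d _} (mk≈ p) = mk≈ (begin
      D.- a D.* d      ≈⟨ D.-‿distribˡ-* a d ⟨
      D.- (a D.* d)    ≈⟨ D.-‿cong p ⟩
      D.- (c D.* b)    ≈⟨ D.-‿distribˡ-* c b ⟩
      D.- c D.* b      ∎)

    +-assoc : ∀ x y z → ((x + y) + z) ≈ (x + (y + z))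
    +-assoc (frac a b _) (frac c d _) (frac e f _) = mk≈
      (solve 6 (λ a b c d e f →
        ((a :* d :+ c :* b) :* f :+ e :* (b :* d)) :* (b :* (d :* f))
        := (a :* (d :* f) :+ (c :* f :+ e :* d) :* b) :* ((b :* d) :* f))
        D.refl a b c d e f)

    +-comm : ∀ x y → (x + y) ≈ (y + x)
    +-comm (frac a b _) (frac c d _) = mk≈
      (solve 4 (λ a b c d → (a :* d :+ c :* b) :* (d :* b)
        := (c :* b :+ a :* d) :* (b :* d)) D.refl a b c d)

    +-identityˡ : ∀ x → (0f + x) ≈ x
    +-identityˡ (frac a b _) = mk≈
      (solve 2 (λ a b → (con 0 :* b :+ a :* con 1) :* b := a :* (con 1 :* b)) D.refl a b)

    -‿inverseˡ : ∀ x → ((- x) + x) ≈ 0f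
    -‿inverseˡ (frac a b _) = mk≈ (begin
      (D.- a D.* b D.+ a D.* b) D.* D.1#   ≈⟨ D.*-identityʳ _ ⟩
      D.- a D.* b D.+ a D.* b              ≈⟨ D.distribʳ b (D.- a) a ⟨
      (D.- a D.+ a) D.* b                  ≈⟨ D.*-congʳ (D.-‿inverseˡ a) ⟩
      D.0# D.* b                           ≈⟨ D.zeroˡ b ⟩
      D.0#                                 ≈⟨ D.zeroˡ _ ⟨
      D.0# D.* (b D.* b)                   ∎)

    *-assoc : ∀ x y z → ((x * y) * z) ≈ (x * (y * z))
    *-assoc (frac a b _) (frac c d _) (frac e f _) = mk≈
      (D.*-cong (D.*-assoc a c e) (D.sym (D.*-assoc b d f)))

    *-comm : ∀ x y → (x * y) ≈ (y * x)
    *-comm (frac a b _) (frac c d _) = mk≈ (D.*-cong (D.*-comm a c) (D.*-comm d b))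

    *-identityˡ : ∀ x → (1f * x) ≈ x
    *-identityˡ (frac a b _) = mk≈
      (D.trans (D.*-congʳ (D.*-identityˡ a)) (D.*-congˡ (D.sym (D.*-identityˡ b))))

    *-distribˡ-+ : ∀ x y z → (x * (y + z)) ≈ (x * y + x * z)
    *-distribˡ-+ (frac a b _) (frac c d _) (frac e f _) = mk≈
      (solve 6 (λ a b c d e f →
        (a :* (c :* f :+ e :* d)) :* ((b :* d) :* (b :* f))
        := ((a :* c) :* (b :* f) :+ (a :* e) :* (b :* d)) :* (b :* (d :* f)))
        D.refl a b c d e f)

    *-distribʳ-+ : ∀ x y z → ((y + z) * x) ≈ (y * x + z * x)
    *-distribʳ-+ x y z = ≈-trans (*-comm (y + z) x)
      (≈-trans (*-distribˡ-+ x y z) (+-cong (*-comm x y) (*-comm x z)))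

  commutativeRing : CommutativeRing 0ℓ 0ℓ
  commutativeRing = record
    { Carrier = Fraction ; _≈_ = _≈_ ; _+_ = _+_ ; _*_ = _*_ ; -_ = -_ ; 0# = 0f ; 1# = 1f
    ; isCommutativeRing = record
      { isRing = record
        { +-isAbelianGroup = record
          { isGroup = record
            { isMonoid = record
              { isSemigroup = record
                { isMagma = record { isEquivalence = ≈-isEquivalence ; ∙-cong = +-cong }
                ; assoc = +-assoc }
              ; identity = +-identityˡ , λ x → ≈-trans (+-comm x 0f) (+-identityˡ x) }
            ; inverse = -‿inverseˡ , λ x → ≈-trans (+-comm x (- x)) (-‿inverseˡ x)
            ; ⁻¹-cong = -‿cong }
          ; comm = +-comm }
        ; *-cong = *-cong
        ; *-assoc = *-assoc
        ; *-identity = *-identityˡ , λ x → ≈-trans (*-comm x 1f) (*-identityˡ x)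
        ; distrib = *-distribˡ-+ , *-distribʳ-+ }
      ; *-comm = *-comm }
    }

  private
    module F = CommutativeRing commutativeRing
    module FP = RingProperties F.ring

    decSetoid : DecSetoid 0ℓ 0ℓ
    decSetoid = record
      { isDecEquivalence = record
        { isEquivalence = ≈-isEquivalence
        ; _≟_ = λ x y → map′ mk≈ cross ((num x D.* den y) D.≟ (num y D.* den x)) } }

    1≉0 : ¬ (1f ≈ 0f)
    1≉0 (mk≈ e) = D.1≉0 (D.trans (D.sym (D.*-identityˡ _)) (D.trans e (D.zeroˡ _)))

    num≉0 : ∀ {x} → ¬ (x ≈ 0f) → num x D.≉ D.0#
    num≉0 x≉0 e = x≉0 (mk≈ (D.trans (D.*-identityʳ _) (D.trans e (D.sym (D.zeroˡ _)))))

    inverse : ∀ x → ¬ (x ≈ 0f) → ∃[ y ] ((y * x) ≈ 1f)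
    inverse x x≉0 = frac (den x) (num x) (num≉0 x≉0) , mk≈ (begin
      den x D.* num x D.* D.1#     ≈⟨ D.*-identityʳ _ ⟩
      den x D.* num x              ≈⟨ D.*-comm _ _ ⟩
      num x D.* den x              ≈⟨ D.*-identityˡ _ ⟨
      D.1# D.* (num x D.* den x)   ∎)

  heytingField : HeytingField 0ℓ 0ℓ 0ℓ
  heytingField = record
    { _#_ = λ x y → ¬ (x ≈ y)
    ; isHeytingField = record
      { isHeytingCommutativeRing = record
        { isCommutativeRing   = F.isCommutativeRing
        ; isApartnessRelation = DecSetoidProperties.≉-isApartnessRelation decSetoid
        ; #⇒invertible = λ {x} {y} x≉y →
            let (z , e) = inverse (x F.- y) (λ e → x≉y (FP.x∙y⁻¹≈ε⇒x≈y x y e))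
            in  z , e , ≈-trans (*-comm (x F.- y) z) e
        ; invertible⇒# = λ {x} {y} (z , e , _) x≈y → 1≉0
            (≈-trans (≈-sym e) (≈-trans (*-cong (≈-refl {z}) (FP.x≈y⇒x∙y⁻¹≈ε x≈y)) (F.zeroʳ z)))
        }
      ; tight = DecSetoidProperties.≉-tight decSetoid
      }
    }

ℚ-integralDomain : IntegralDomain
ℚ-integralDomain = record
  { commutativeRing = ℚ.+-*-commutativeRing
  ; _≟_             = ℚ._≟_
  ; 1≉0             = λ ()
  ; noZeroDivisors  = nzd
  }
  where
  open import Algebra.Apartness.Properties.HeytingCommutativeRing ℚ.heytingCommutativeRing
    using (x#0y#0→xy#0)
  open import Data.Rational.Base using (_*_; 0ℚ)
  open import Relation.Binary.PropositionalEquality.Core using (_≡_)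
  nzd : ∀ {x y} → x * y ≡ 0ℚ → x ≡ 0ℚ ⊎ y ≡ 0ℚ
  nzd {x} {y} e with x ℚ.≟ 0ℚ | y ℚ.≟ 0ℚ
  ... | yes x≡0 | _       = inj₁ x≡0
  ... | no _    | yes y≡0 = inj₂ y≡0
  ... | no x≢0  | no y≢0  = ⊥-elim (x#0y#0→xy#0 x≢0 y≢0 e)

-- ℚ[t₁, …, t_k], built as ℚ[t₁][t₂]⋯[t_k]
PolynomialRing : ℕ → IntegralDomain
PolynomialRing zero    = ℚ-integralDomain
PolynomialRing (suc k) = Polynomial.integralDomain (PolynomialRing k)

-- ℚ(t₁, …, t_k); for k = 0 these are fractions of rational numbers, a copy of ℚ
RationalFunctionField : ℕ → HeytingField 0ℓ 0ℓ 0ℓ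
RationalFunctionField k = FractionField.heytingField (PolynomialRing k)

{-# OPTIONS --safe #-}

-- All solutions are rational.  If the 2n numbers are closed under inversion and pair up as
-- x, x⁻¹, then σ₂ₙ = 1 and σ₂ₙ₋ᵢ = σᵢ, so only σᵢ = a remains.  Most of the numbers are spent
-- on quadruples u, -u, u⁻¹, -u⁻¹, whose generating polynomial 1 - (u² + u⁻²) X² + X⁴ is even;
-- the u are chosen generically so that the coefficients that matter do not vanish.
--
-- * i even: two further numbers z and ±z⁻¹ (suitably scaled) enter σᵢ only through their
--   product, so z is free.
-- * i = 1, n odd: σ₁ does not see the quadruples, whose u are free.
-- * i ≥ 3 odd, n odd: with three pairs of traces x, y, z, where the trace of u is u + u⁻¹,
--   σᵢ is a combination of x + y + z and xyz.  The surface σᵢ = a meets its tangent plane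
--   at x = y = 2 in a conic, which is m² + n² = const in the coordinates m = (u + 1)/(u - 1);
--   z is chosen so that the conic has a rational point.
-- * i odd, n even: two pairs contribute a multiple of y + y⁻¹ + z + z⁻¹, so we need infinitely
--   many elliptic curves y + y⁻¹ + z + z⁻¹ = t of positive rank.  Doubling a point whose
--   coordinates have 2-adic valuation -k gives one with valuation -(k + 1).

module Submission where

open import Defs
open import Algebra.Apartness.Bundles using (HeytingField; HeytingCommutativeRing)
open import Algebra.Bundles using (CommutativeRing)
open import Data.Nat.Base using (ℕ; _≤_; _∸_) renaming (_*_ to _*ℕ_)
open import Data.Product.Base using (_×_)
open import Data.Vec.Functional.Relation.Binary.Equality.Setoid using (≋-setoid)

open import Algebra.Morphism.Construct.Composition using (isRingMonomorphism)
import Algebra.Morphism.Construct.Identity as Identity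
open import Algebra.Morphism.Structures using (module RingMorphisms)
import Algebra.Properties.Group as GroupProperties
open import Data.Empty using (⊥-elim)
import Data.Fin.Base as Fin
open import Data.Integer.Base as ℤ using (ℤ)
import Data.Integer.Properties as ℤ
open import Data.List.Base using (List; []; _∷_; _++_; map; foldr; length; lookup; allFin; replicate)
import Data.List.Membership.Setoid as Membership
import Data.List.Membership.Setoid.Properties as Membershipₚ
open import Data.List.Properties using
  (map-++; map-tabulate; tabulate-lookup; length-map; length-replicate; ≡-dec; ∷-injectiveˡ; ∷-injectiveʳ)
open import Data.List.Relation.Unary.All as All using (All; []; _∷_)
open import Data.List.Relation.Unary.Any using (here; there)
open import Data.Nat.Base as ℕ using (zero; suc; z≤n; s≤s)
import Data.Nat.Properties as ℕ
open import Data.Product.Base using (_,_; ∃-syntax; Σ-syntax)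
open import Data.Rational.Base as ℚ hiding (_≤_)
open import Data.Rational.Literals using (fromℤ)
open import Data.Rational.Properties
import Data.Rational.Unnormalised.Base as ℚᵘ
import Data.Rational.Unnormalised.Properties as ℚᵘ
open import Data.Sum.Base as Sum using (_⊎_; inj₁; inj₂; [_,_]′)
open import Data.Unit.Base using (⊤; tt)
open import Data.Vec.Functional using (Vector)
import Data.Vec.Functional.Relation.Binary.Pointwise.Properties as Pointwise
open import Function.Base using (_∘_; id)
open import Level using (0ℓ)
open import Relation.Binary.Bundles using (Setoid)
import Relation.Binary.Construct.On as On
open import Relation.Binary.Core using (Rel)
open import Relation.Binary.Definitions using (Decidable; Transitive; Irreflexive; tri<; tri≈; tri>)
open import Relation.Binary.PropositionalEquality as ≡ hiding ([_]; setoid)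
open import Relation.Nullary using (yes; no; ¬_)
open import Relation.Nullary.Decidable using (dec⇒maybe; map′; toWitness)
open import Tactic.RingSolver using (solve-∀)
open import Tactic.RingSolver.Core.AlmostCommutativeRing using
  (AlmostCommutativeRing; fromCommutativeRing)

-- Infinite sets and maps with finite fibres.

module _ {c ℓ p} {S : Setoid c ℓ} {P : Setoid.Carrier S → Set p} where
  open Membership S

  infinite-avoid : ∀ zs → Infinite S P → Infinite S (λ x → P x × x ∉ zs)
  infinite-avoid zs inf xs with inf (zs ++ xs)
  ... | x , px , x∉ = x , (px , x∉ ∘ Membershipₚ.∈-++⁺ˡ S) , x∉ ∘ Membershipₚ.∈-++⁺ʳ S zs

  module _ {c′ ℓ′ q} {S′ : Setoid c′ ℓ′} (_≟_ : Decidable (Setoid._≈_ S′))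
           {Q : Setoid.Carrier S′ → Set q} where
    private module S′ = Setoid S′
    open Membership S′ using () renaming (_∉_ to _∉′_)

    -- Fibres are finite and given as lists. When the point `x` that was found is sent to a
    -- forbidden value `z`, everything sent to `z` lies in `fibre x`; a second search outside that
    -- list misses `z` for good.
    infinite-image : (f : ∀ x → P x → S′.Carrier) (fibre : Setoid.Carrier S → List (Setoid.Carrier S)) →
      (∀ {x y} (px : P x) (py : P y) → f x px S′.≈ f y py → y ∈ fibre x) →
      (∀ {x} (px : P x) → Q (f x px)) →
      Infinite S P → Infinite S′ Q
    infinite-image f fibre fib good inf xs with go xs []
      where
      go : ∀ xs ys → ∃[ x ] Σ[ px ∈ P x ] (x ∉ ys × f x px ∉′ xs)
      go [] ys with inf ys
      ... | x , px , x∉ys = x , px , x∉ys , λ ()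
      go (z ∷ xs) ys with go xs ys
      ... | x , px , x∉ys , fx∉xs with f x px ≟ z
      ...   | no fx≉z = x , px , x∉ys , λ { (here fx≈z) → fx≉z fx≈z ; (there fx∈xs) → fx∉xs fx∈xs }
      ...   | yes fx≈z with go xs (fibre x ++ ys)
      ...     | y , py , y∉ , fy∉xs = y , py , y∉ ∘ Membershipₚ.∈-++⁺ʳ S (fibre x) , λ
        { (here fy≈z) → y∉ (Membershipₚ.∈-++⁺ˡ S (fib px py (S′.trans fx≈z (S′.sym fy≈z))))
        ; (there fy∈xs) → fy∉xs fy∈xs }
    ... | x , px , _ , fx∉xs = f x px , good px , fx∉xs

infinite-⊆ : ∀ {c ℓ p q} {S : Setoid c ℓ} {P : Setoid.Carrier S → Set p} {Q : Setoid.Carrier S → Set q} →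
  (∀ {x} → P x → Q x) → Infinite S P → Infinite S Q
infinite-⊆ P⊆Q inf xs = let x , px , x∉ = inf xs in x , P⊆Q px , x∉

-- Elementary symmetric polynomials by recursion on lists.

-- The coefficient of X^k in the product of the factors 1 + xX. `σ-lookup` links this form with the
-- sum over index sets.
e : List ℚ → ℕ → ℚ
e xs       zero    = 1ℚ
e []       (suc k) = 0ℚ
e (x ∷ xs) (suc k) = x * e xs k + e xs (suc k)

module _ (R : CommutativeRing 0ℓ 0ℓ) (ι : ℚ → CommutativeRing.Carrier R)
         (ι-mono : RingMorphisms.IsRingMonomorphism (CommutativeRing.rawRing +-*-commutativeRing)
                     (CommutativeRing.rawRing R) ι) where
  open CommutativeRing R using (_≈_)
  private
    module R = CommutativeRing R
    module ι = RingMorphisms.IsRingMonomorphism ι-mono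
  open ElementarySymmetric R
  open import Relation.Binary.Reasoning.Setoid R.setoid

  private
    ∑ : List R.Carrier → R.Carrier
    ∑ = foldr R._+_ R.0#

    ∑-++ : ∀ xs ys → ∑ (xs ++ ys) ≈ ∑ xs R.+ ∑ ys
    ∑-++ []       ys = R.sym (R.+-identityˡ _)
    ∑-++ (x ∷ xs) ys = R.trans (R.+-congˡ (∑-++ xs ys)) (R.sym (R.+-assoc _ _ _))

  module _ {A : Set} (g : A → ℚ) where
    private
      ∏ : List A → R.Carrier
      ∏ = foldr R._*_ R.1# ∘ map (ι ∘ g)

      ∑-∏-∷ : ∀ x yss → ∑ (map ∏ (map (x ∷_) yss)) ≈ ι (g x) R.* ∑ (map ∏ yss)
      ∑-∏-∷ x []         = R.sym (R.zeroʳ _)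
      ∑-∏-∷ x (ys ∷ yss) = R.trans (R.+-congˡ (∑-∏-∷ x yss)) (R.sym (R.distribˡ _ _ _))

    -- The two branches of `choose`, first position taken or skipped, are the two summands of `e`.
    -- The index type is arbitrary because the tail of an `allFin` is not itself an `allFin`.
    ∑-choose≈e : ∀ k xs → ∑ (map ∏ (choose k xs)) ≈ ι (e (map g xs) k)
    ∑-choose≈e zero    xs       = R.trans (R.+-identityʳ _) (R.sym ι.1#-homo)
    ∑-choose≈e (suc k) []       = R.sym ι.0#-homo
    ∑-choose≈e (suc k) (x ∷ xs) = begin
      ∑ (map ∏ (map (x ∷_) (choose k xs) ++ choose (suc k) xs))
        ≡⟨ cong ∑ (map-++ ∏ (map (x ∷_) (choose k xs)) _) ⟩
      ∑ (map ∏ (map (x ∷_) (choose k xs)) ++ map ∏ (choose (suc k) xs))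
        ≈⟨ ∑-++ (map ∏ (map (x ∷_) (choose k xs))) _ ⟩
      ∑ (map ∏ (map (x ∷_) (choose k xs))) R.+ ∑ (map ∏ (choose (suc k) xs))
        ≈⟨ R.+-cong (R.trans (∑-∏-∷ x (choose k xs)) (R.*-congˡ (∑-choose≈e k xs))) (∑-choose≈e (suc k) xs) ⟩
      ι (g x) R.* ι (e (map g xs) k) R.+ ι (e (map g xs) (suc k))
        ≈⟨ R.trans (ι.+-homo _ _) (R.+-congʳ (ι.*-homo _ _)) ⟨
      ι (e (map g (x ∷ xs)) (suc k)) ∎

  σ-lookup : ∀ k xs → σ k (ι ∘ lookup xs) ≈ ι (e xs k)
  σ-lookup k xs = begin
    σ k (ι ∘ lookup xs)                          ≈⟨ ∑-choose≈e (lookup xs) k (allFin (length xs)) ⟩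
    ι (e (map (lookup xs) (allFin (length xs))) k)
      ≡⟨ cong (λ ys → ι (e ys k)) (trans (map-tabulate id (lookup xs)) (tabulate-lookup xs)) ⟩
    ι (e xs k) ∎

-- The embedding of ℚ into the rational function field.

module _ (D : IntegralDomain) where
  private
    module D = IntegralDomain D
    module P = Polynomial D
    module F = FractionField D

  constant-isRingMonomorphism :
    RingMorphisms.IsRingMonomorphism D.rawRing
      (CommutativeRing.rawRing P.commutativeRing) (_∷ [])
  constant-isRingMonomorphism = record
    { isRingHomomorphism = record { isSemiringHomomorphism = record
      { isNearSemiringHomomorphism = record
        { +-isMonoidHomomorphism = record
          { isMagmaHomomorphism = record
            { isRelHomomorphism = record { cong = λ x≈y → P.mk≈ λ { zero → x≈y ; (suc n) → D.refl } }
            ; homo = λ x y → P.mk≈ λ n → D.refl }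
          ; ε-homo = P.mk≈ λ { zero → D.refl ; (suc n) → D.refl } }
        ; *-homo = λ x y → P.mk≈ λ { zero → D.sym (D.+-identityʳ _) ; (suc n) → D.refl } }
      ; 1#-homo = P.mk≈ λ n → D.refl }
    ; -‿homo = λ x → P.mk≈ λ n → D.refl }
    ; injective = λ x≈y → P._≈_.at x≈y 0
    }

  fraction : D.Carrier → F.Fraction
  fraction x = F.frac x D.1# D.1≉0

  fraction-isRingMonomorphism :
    RingMorphisms.IsRingMonomorphism D.rawRing
      (CommutativeRing.rawRing F.commutativeRing) fraction
  fraction-isRingMonomorphism = record
    { isRingHomomorphism = record { isSemiringHomomorphism = record
      { isNearSemiringHomomorphism = record
        { +-isMonoidHomomorphism = record
          { isMagmaHomomorphism = record
            { isRelHomomorphism = record { cong = λ x≈y → F.mk≈ (D.*-congʳ x≈y) }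
            ; homo = λ x y → F.mk≈ (D.*-cong (D.sym (D.+-cong (D.*-identityʳ x) (D.*-identityʳ y))) (D.*-identityʳ _)) }
          ; ε-homo = F.mk≈ D.refl }
        ; *-homo = λ x y → F.mk≈ (D.*-congˡ (D.*-identityʳ _)) }
      ; 1#-homo = F.mk≈ D.refl }
    ; -‿homo = λ x → F.mk≈ D.refl }
    ; injective = λ { (F.mk≈ e) → D.trans (D.sym (D.*-identityʳ _)) (D.trans e (D.*-identityʳ _)) }
    }

  fraction-≟ : Decidable F._≈_
  fraction-≟ (F.frac a b _) (F.frac c d _) = map′ F.mk≈ F._≈_.cross (a D.* d D.≟ c D.* b)

constant : ∀ k → ℚ → IntegralDomain.Carrier (PolynomialRing k)
constant zero    x = x
constant (suc k) x = constant k x ∷ []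

constant-mono : ∀ k → RingMorphisms.IsRingMonomorphism (CommutativeRing.rawRing +-*-commutativeRing)
  (IntegralDomain.rawRing (PolynomialRing k)) (constant k)
constant-mono zero    = Identity.isRingMonomorphism _ refl
constant-mono (suc k) = isRingMonomorphism (IntegralDomain.trans (PolynomialRing (suc k)))
  (constant-mono k) (constant-isRingMonomorphism (PolynomialRing k))

-- Reduction to the system over ℚ.

IsSolution : ℕ → ℕ → ℚ → List ℚ → Set
IsSolution i n a xs =
  length xs ≡ 2 *ℕ n × e xs i ≡ a × e xs (2 *ℕ n ∸ i) ≡ a × e xs (2 *ℕ n) ≡ 1ℚ

ManySolutions : ℕ → ℕ → ℚ → Set
ManySolutions i n a = Infinite (≡.setoid (List ℚ)) (IsSolution i n a)

NonzeroManySolutions : ℕ → ℕ → Set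
NonzeroManySolutions i n = Infinite (≡.setoid ℚ) (λ a → a ≢ 0ℚ × ManySolutions i n a)

vector : ∀ (xs : List ℚ) {m} → length xs ≡ m → Vector ℚ m
vector xs refl = lookup xs

vector-suc : ∀ x (xs : List ℚ) {m} (eq : length (x ∷ xs) ≡ suc m) j →
  vector (x ∷ xs) eq (Fin.suc j) ≡ vector xs (ℕ.suc-injective eq) j
vector-suc x xs refl j = refl

vector-zero : ∀ x (xs : List ℚ) {m} (eq : length (x ∷ xs) ≡ suc m) → vector (x ∷ xs) eq Fin.zero ≡ x
vector-zero x xs refl = refl

vector-injective : ∀ (xs ys : List ℚ) {m} (p : length xs ≡ m) (q : length ys ≡ m) →
  (∀ j → vector xs p j ≡ vector ys q j) → xs ≡ ys
vector-injective []       []       p    q h = refl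
vector-injective []       (y ∷ ys) refl () h
vector-injective (x ∷ xs) []       refl () h
vector-injective (x ∷ xs) (y ∷ ys) {suc m} p q h = cong₂ _∷_
  (trans (sym (vector-zero x xs p)) (trans (h Fin.zero) (vector-zero y ys q)))
  (vector-injective xs ys (ℕ.suc-injective p) (ℕ.suc-injective q) λ j →
    trans (sym (vector-suc x xs p j)) (trans (h (Fin.suc j)) (vector-suc y ys q j)))

-- Both infinite sets, of values `a` and of solutions, are pushed forward along the injective
-- embedding of ℚ, so all fibres are singletons.
transfer-from-ℚ : ∀ i n → NonzeroManySolutions i n →
    let F = HeytingField.heytingCommutativeRing (RationalFunctionField (n ∸ 2))
        R = HeytingCommutativeRing.commutativeRing F
        open CommutativeRing R
        open ElementarySymmetric R
    in Infinite setoid (λ a → a ≉ 0# ×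
         Infinite (≋-setoid setoid (2 *ℕ n)) (λ x →
           σ i x ≈ a × σ (2 *ℕ n ∸ i) x ≈ a × σ (2 *ℕ n) x ≈ 1#))
transfer-from-ℚ i n = infinite-image {S = ≡.setoid ℚ} {S′ = R.setoid} (fraction-≟ (PolynomialRing (n ∸ 2)))
  (λ a _ → ι a) (_∷ [])
  (λ _ _ ιa≈ιb → here (sym (ι.injective ιa≈ιb)))
  λ {a} (a≢0 , many) → (λ ιa≈0 → a≢0 (ι.injective (R.trans ιa≈0 (R.sym ι.0#-homo)))) ,
    infinite-image {S = ≡.setoid (List ℚ)} {S′ = ≋-setoid R.setoid (2 *ℕ n)}
      (Pointwise.decidable (fraction-≟ (PolynomialRing (n ∸ 2))))
      (λ xs (len , _) → ι ∘ vector xs len) (_∷ [])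
      (λ {xs} {ys} (p , _) (q , _) eq → here (sym (vector-injective xs ys p q λ j → ι.injective (eq j))))
      (λ {xs} (len , σᵢ , σ₂ₙ₋ᵢ , σ₂ₙ) →
        σ-vector i xs len σᵢ , σ-vector (2 *ℕ n ∸ i) xs len σ₂ₙ₋ᵢ ,
        R.trans (σ-vector (2 *ℕ n) xs len σ₂ₙ) ι.1#-homo)
      many
  where
  R : CommutativeRing 0ℓ 0ℓ
  R = FractionField.commutativeRing (PolynomialRing (n ∸ 2))
  module R = CommutativeRing R
  open ElementarySymmetric R
  ι : ℚ → R.Carrier
  ι = fraction (PolynomialRing (n ∸ 2)) ∘ constant (n ∸ 2)
  ι-mono : RingMorphisms.IsRingMonomorphism (CommutativeRing.rawRing +-*-commutativeRing) R.rawRing ι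
  ι-mono = isRingMonomorphism R.trans (constant-mono (n ∸ 2)) (fraction-isRingMonomorphism (PolynomialRing (n ∸ 2)))
  module ι = RingMorphisms.IsRingMonomorphism ι-mono
  σ-vector : ∀ k xs {m} (len : length xs ≡ m) {a} → e xs k ≡ a → σ k (ι ∘ vector xs len) R.≈ ι a
  σ-vector k xs refl refl = σ-lookup R ι ι-mono k xs

-- Unbounded sets of natural and rational numbers.

-- By directedness some element lies strictly above `x` and every entry of the list; irreflexivity
-- keeps it out of the list.
infinite-upper-set : ∀ {A : Set} (_≺_ : Rel A 0ℓ) → Transitive _≺_ → Irreflexive _≡_ _≺_ →
  (∀ x y → ∃[ z ] (x ≺ z × y ≺ z)) → ∀ x → Infinite (≡.setoid A) (x ≺_)
infinite-upper-set _≺_ ≺-trans ≺-irrefl bound x xs with above x xs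
  where
  above : ∀ x xs → ∃[ z ] (x ≺ z × All (_≺ z) xs)
  above x [] with bound x x
  ... | z , x≺z , _ = z , x≺z , []
  above x (y ∷ xs) with bound x y
  ... | w , x≺w , y≺w with above w xs
  ... | z , w≺z , xs≺z = z , ≺-trans x≺w w≺z , ≺-trans y≺w w≺z ∷ xs≺z
... | z , x≺z , xs≺z = z , x≺z , λ z∈xs → ≺-irrefl refl (All.lookup xs≺z z∈xs)

infinite-ℕ : ∀ m → Infinite (≡.setoid ℕ) (m ℕ.<_)
infinite-ℕ = infinite-upper-set ℕ._<_ ℕ.<-trans ℕ.<-irrefl
  λ m n → suc (m ℕ.+ n) , s≤s (ℕ.m≤m+n m n) , s≤s (ℕ.m≤n+m n m)

infinite-ℚ : ∀ p → Infinite (≡.setoid ℚ) (p <_)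
infinite-ℚ = infinite-upper-set _<_ <-trans <-irrefl
  λ p q → p ⊔ q + 1ℚ , ≤-<-trans (p≤p⊔q p q) (x<x+1 (p ⊔ q)) , ≤-<-trans (p≤q⊔p p q) (x<x+1 (p ⊔ q))
  where
  x<x+1 : ∀ x → x < x + 1ℚ
  x<x+1 x = subst (_< x + 1ℚ) (+-identityʳ x) (+-monoʳ-< x (positive⁻¹ 1ℚ))

ℚ-ring : AlmostCommutativeRing _ _
ℚ-ring = fromCommutativeRing +-*-commutativeRing (λ x → dec⇒maybe (0ℚ ≟ x))

zero-product : ∀ {x y} → x * y ≡ 0ℚ → x ≡ 0ℚ ⊎ y ≡ 0ℚ
zero-product = IntegralDomain.noZeroDivisors ℚ-integralDomain

*-≢0 : ∀ {x y} → x ≢ 0ℚ → y ≢ 0ℚ → x * y ≢ 0ℚ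
*-≢0 = IntegralDomain.*-≉0 ℚ-integralDomain

-- Reciprocal lists and their generating polynomials

-- The inverse is carried as data, so that identities between fractions become ring identities in
-- `val` and `inv`, up to multiples of the relation `val*inv≡1`.
record Unit : Set where
  constructor unit
  field
    val inv : ℚ
    val*inv≡1 : val * inv ≡ 1ℚ
open Unit

mkUnit : ∀ x → x ≢ 0ℚ → Unit
mkUnit x x≢0 = unit x (1/ x) (*-inverseʳ x)
  where instance _ = ≢-nonZero x≢0

flip : Unit → Unit
flip (unit x x⁻¹ eq) = unit x⁻¹ x (trans (*-comm x⁻¹ x) eq)

opposite : Unit → Unit
opposite (unit x x⁻¹ eq) = unit (- x) (- x⁻¹) (trans (lemma x x⁻¹) eq)
  where
  lemma : ∀ x y → - x * - y ≡ x * y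
  lemma = solve-∀ ℚ-ring

trace : Unit → ℚ
trace u = val u + inv u

trace₂ : Unit → ℚ
trace₂ u = val u * val u + inv u * inv u

shift : (ℕ → ℚ) → ℕ → ℚ
shift c zero    = 0ℚ
shift c (suc k) = c k

-- Multiplication of a power series by x + yX + wX².
quad : ℚ → ℚ → ℚ → (ℕ → ℚ) → ℕ → ℚ
quad x y w c k = x * c k + y * shift c k + w * shift (shift c) k

shift-cong : ∀ {c d} → (∀ k → c k ≡ d k) → ∀ k → shift c k ≡ shift d k
shift-cong c≗d zero    = refl
shift-cong c≗d (suc k) = c≗d k

quad-cong : ∀ x y w {c d} → (∀ k → c k ≡ d k) → ∀ k → quad x y w c k ≡ quad x y w d k
quad-cong x y w c≗d k = cong₂ _+_
  (cong₂ _+_ (cong (x *_) (c≗d k)) (cong (y *_) (shift-cong c≗d k)))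
  (cong (w *_) (shift-cong (shift-cong c≗d) k))

shift-quad : ∀ x y w c k → shift (quad x y w c) k ≡ quad x y w (shift c) k
shift-quad x y w c zero = lemma x y w
  where
  lemma : ∀ x y w → 0ℚ ≡ x * 0ℚ + y * 0ℚ + w * 0ℚ
  lemma = solve-∀ ℚ-ring
shift-quad x y w c (suc k) = refl

quad-∘ : ∀ x y w x′ y′ w′ c k → quad x y w (quad x′ y′ w′ c) k ≡
  x * x′ * c k + (x * y′ + y * x′) * shift c k + (x * w′ + y * y′ + w * x′) * shift (shift c) k
  + (y * w′ + w * y′) * shift (shift (shift c)) k + w * w′ * shift (shift (shift (shift c))) k
quad-∘ x y w x′ y′ w′ c k
  rewrite shift-cong (shift-quad x′ y′ w′ c) k | shift-quad x′ y′ w′ (shift c) k | shift-quad x′ y′ w′ c k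
  = lemma x y w x′ y′ w′ (c k) (shift c k) (shift (shift c) k)
      (shift (shift (shift c)) k) (shift (shift (shift (shift c))) k)
  where
  lemma : ∀ x y w x′ y′ w′ c₀ c₁ c₂ c₃ c₄ →
    x * (x′ * c₀ + y′ * c₁ + w′ * c₂) + y * (x′ * c₁ + y′ * c₂ + w′ * c₃) + w * (x′ * c₂ + y′ * c₃ + w′ * c₄) ≡
    x * x′ * c₀ + (x * y′ + y * x′) * c₁ + (x * w′ + y * y′ + w * x′) * c₂ + (y * w′ + w * y′) * c₃ + w * w′ * c₄
  lemma = solve-∀ ℚ-ring

quad-comm : ∀ x y w x′ y′ w′ c k →
  quad x y w (quad x′ y′ w′ c) k ≡ quad x′ y′ w′ (quad x y w c) k
quad-comm x y w x′ y′ w′ c k = trans (quad-∘ x y w x′ y′ w′ c k) (trans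
  (lemma x y w x′ y′ w′ (c k) (shift c k) (shift (shift c) k)
    (shift (shift (shift c)) k) (shift (shift (shift (shift c))) k))
  (sym (quad-∘ x′ y′ w′ x y w c k)))
  where
  lemma : ∀ x y w x′ y′ w′ c₀ c₁ c₂ c₃ c₄ →
    x * x′ * c₀ + (x * y′ + y * x′) * c₁ + (x * w′ + y * y′ + w * x′) * c₂ + (y * w′ + w * y′) * c₃ + w * w′ * c₄ ≡
    x′ * x * c₀ + (x′ * y + y′ * x) * c₁ + (x′ * w + y′ * y + w′ * x) * c₂ + (y′ * w + w′ * y) * c₃ + w′ * w * c₄
  lemma = solve-∀ ℚ-ring

-- This is (1 + xX)(1 + yX) = 1 + (x + y)X + xyX².
e-∷-∷ : ∀ x y xs k → e (x ∷ y ∷ xs) k ≡ quad 1ℚ (x + y) (x * y) (e xs) k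
e-∷-∷ x y xs zero = lemma x y
  where
  lemma : ∀ x y → 1ℚ ≡ 1ℚ * 1ℚ + (x + y) * 0ℚ + x * y * 0ℚ
  lemma = solve-∀ ℚ-ring
e-∷-∷ x y xs (suc zero) = lemma x y (e xs 1)
  where
  lemma : ∀ x y c → x * 1ℚ + (y * 1ℚ + c) ≡ 1ℚ * c + (x + y) * 1ℚ + x * y * 0ℚ
  lemma = solve-∀ ℚ-ring
e-∷-∷ x y xs (suc (suc k)) = lemma x y (e xs k) (e xs (suc k)) (e xs (suc (suc k)))
  where
  lemma : ∀ x y c₀ c₁ c₂ → x * (y * c₀ + c₁) + (y * c₁ + c₂) ≡ 1ℚ * c₂ + (x + y) * c₁ + x * y * c₀
  lemma = solve-∀ ℚ-ring

e-beyond : ∀ xs {k} → length xs ℕ.< k → e xs k ≡ 0ℚ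
e-beyond []       (s≤s _) = refl
e-beyond (x ∷ xs) {suc k} (s≤s h) = trans
  (cong₂ _+_ (cong (x *_) (e-beyond xs h)) (e-beyond xs (ℕ.m<n⇒m<1+n h))) (lemma x)
  where
  lemma : ∀ x → x * 0ℚ + 0ℚ ≡ 0ℚ
  lemma = solve-∀ ℚ-ring

module _ where
  private
    vals invs : List Unit → List ℚ
    vals = map val
    invs = map inv

  -- The product over `a` of the numbers is the full product times the inverses of the other `b`. At
  -- the ends of the induction a coefficient beyond the length appears, which is zero.
  e-reversal : ∀ us a b → a ℕ.+ b ≡ length us →
    e (vals us) a ≡ foldr _*_ 1ℚ (vals us) * e (invs us) b
  e-reversal [] zero zero eq = refl
  e-reversal (u@(unit x x⁻¹ xx⁻¹≡1) ∷ us) zero (suc b) refl = begin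
    1ℚ                                          ≡⟨ cong₂ _*_ xx⁻¹≡1 (sym (e-reversal us 0 b refl)) ⟨
    x * x⁻¹ * (p * e (invs us) b)               ≡⟨ lemma x x⁻¹ p (e (invs us) b) ⟩
    x * p * (x⁻¹ * e (invs us) b + 0ℚ)
      ≡⟨ cong (λ t → x * p * (x⁻¹ * e (invs us) b + t))
           (e-beyond (invs us) (s≤s (ℕ.≤-reflexive (length-map inv us)))) ⟨
    x * p * (x⁻¹ * e (invs us) b + e (invs us) (suc b)) ∎
    where
    open ≡-Reasoning
    p = foldr _*_ 1ℚ (vals us)
    lemma : ∀ x x⁻¹ p c → x * x⁻¹ * (p * c) ≡ x * p * (x⁻¹ * c + 0ℚ)
    lemma = solve-∀ ℚ-ring
  e-reversal (unit x x⁻¹ xx⁻¹≡1 ∷ us) (suc a) zero eq = begin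
    x * e (vals us) a + e (vals us) (suc a)
      ≡⟨ cong₂ (λ s t → x * s + t) (e-reversal us a 0 (ℕ.suc-injective eq))
           (e-beyond (vals us) (s≤s (ℕ.≤-reflexive (trans (length-map val us)
             (sym (trans (sym (ℕ.+-identityʳ a)) (ℕ.suc-injective eq))))))) ⟩
    x * (p * 1ℚ) + 0ℚ      ≡⟨ lemma x p ⟩
    x * p * 1ℚ ∎
    where
    open ≡-Reasoning
    p = foldr _*_ 1ℚ (vals us)
    lemma : ∀ x p → x * (p * 1ℚ) + 0ℚ ≡ x * p * 1ℚ
    lemma = solve-∀ ℚ-ring
  e-reversal (unit x x⁻¹ xx⁻¹≡1 ∷ us) (suc a) (suc b) eq = begin
    x * e (vals us) a + e (vals us) (suc a)
      ≡⟨ cong₂ (λ s t → x * s + t) (e-reversal us a (suc b) (ℕ.suc-injective eq))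
           (e-reversal us (suc a) b (trans (sym (ℕ.+-suc a b)) (ℕ.suc-injective eq))) ⟩
    x * (p * c₁) + p * c₀
      ≡⟨ cong (λ t → x * (p * c₁) + t) (trans (cong (_* (p * c₀)) xx⁻¹≡1) (*-identityˡ _)) ⟨
    x * (p * c₁) + x * x⁻¹ * (p * c₀)  ≡⟨ lemma x x⁻¹ p c₀ c₁ ⟩
    x * p * (x⁻¹ * c₀ + c₁) ∎
    where
    open ≡-Reasoning
    p = foldr _*_ 1ℚ (vals us)
    c₀ = e (invs us) b
    c₁ = e (invs us) (suc b)
    lemma : ∀ x x⁻¹ p c₀ c₁ → x * (p * c₁) + x * x⁻¹ * (p * c₀) ≡ x * p * (x⁻¹ * c₀ + c₁)
    lemma = solve-∀ ℚ-ring

double : ℕ → ℕ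
double zero    = zero
double (suc n) = suc (suc (double n))

withInverses : List Unit → List Unit
withInverses []       = []
withInverses (u ∷ us) = u ∷ flip u ∷ withInverses us

reciprocal : List Unit → List ℚ
reciprocal us = map val (withInverses us)

length-reciprocal : ∀ us → length (reciprocal us) ≡ double (length us)
length-reciprocal []       = refl
length-reciprocal (u ∷ us) = cong (suc ∘ suc) (length-reciprocal us)

e-reciprocal : ∀ u us k → e (reciprocal (u ∷ us)) k ≡ quad 1ℚ (trace u) 1ℚ (e (reciprocal us)) k
e-reciprocal u us k = trans (e-∷-∷ (val u) (inv u) (reciprocal us) k)
  (cong (λ w → quad 1ℚ (trace u) w (e (reciprocal us)) k) (val*inv≡1 u))

-- Special case of `e-reversal`: the full product is 1, and inversion only swaps the two members of
-- each pair.
e-palindromic : ∀ us a b → a ℕ.+ b ≡ double (length us) → e (reciprocal us) a ≡ e (reciprocal us) b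
e-palindromic us a b eq = begin
  e (reciprocal us) a  ≡⟨ e-reversal (withInverses us) a b (trans eq (sym (length-withInverses us))) ⟩
  foldr _*_ 1ℚ (reciprocal us) * e (map inv (withInverses us)) b ≡⟨ cong₂ _*_ (∏≡1 us) (swap us b) ⟩
  1ℚ * e (reciprocal us) b  ≡⟨ *-identityˡ _ ⟩
  e (reciprocal us) b ∎
  where
  open ≡-Reasoning
  length-withInverses : ∀ us → length (withInverses us) ≡ double (length us)
  length-withInverses []       = refl
  length-withInverses (u ∷ us) = cong (suc ∘ suc) (length-withInverses us)
  ∏≡1 : ∀ us → foldr _*_ 1ℚ (reciprocal us) ≡ 1ℚ
  ∏≡1 []       = refl
  ∏≡1 (u ∷ us) = trans (sym (*-assoc (val u) (inv u) _))
    (trans (cong₂ _*_ (val*inv≡1 u) (∏≡1 us)) (*-identityˡ 1ℚ))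
  swap : ∀ us k → e (map inv (withInverses us)) k ≡ e (reciprocal us) k
  swap []       k = refl
  swap (u ∷ us) k = begin
    e (inv u ∷ val u ∷ map inv (withInverses us)) k ≡⟨ e-∷-∷ (inv u) (val u) _ k ⟩
    quad 1ℚ (inv u + val u) (inv u * val u) (e (map inv (withInverses us))) k
      ≡⟨ cong₂ (λ y w → quad 1ℚ y w (e (map inv (withInverses us))) k)
           (+-comm (inv u) (val u)) (*-comm (inv u) (val u)) ⟩
    quad 1ℚ (val u + inv u) (val u * inv u) (e (map inv (withInverses us))) k
      ≡⟨ quad-cong 1ℚ (val u + inv u) (val u * inv u) (swap us) k ⟩
    quad 1ℚ (val u + inv u) (val u * inv u) (e (reciprocal us)) k  ≡⟨ e-∷-∷ (val u) (inv u) _ k ⟨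
    e (reciprocal (u ∷ us)) k ∎

e-top : ∀ us → e (reciprocal us) (double (length us)) ≡ 1ℚ
e-top us = e-palindromic us (double (length us)) 0 (ℕ.+-identityʳ _)

-- Quadruples u, u⁻¹, -u, -u⁻¹ and their even generating polynomial.

withNegatives : List Unit → List Unit
withNegatives []       = []
withNegatives (u ∷ us) = u ∷ opposite u ∷ withNegatives us

length-withNegatives : ∀ us → length (withNegatives us) ≡ double (length us)
length-withNegatives []       = refl
length-withNegatives (u ∷ us) = cong (suc ∘ suc) (length-withNegatives us)

-- K us k is the coefficient of X²ᵏ in ∏ᵤ (1 - (u² + u⁻²) X² + X⁴).
K : List Unit → ℕ → ℚ
K []       zero    = 1ℚ
K []       (suc k) = 0ℚ
K (u ∷ us) k       = quad 1ℚ (- trace₂ u) 1ℚ (K us) k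

evens : List Unit → List ℚ
evens us = reciprocal (withNegatives us)

private
  -- With t = u + u⁻¹ one has (1 + tX + X²)(1 - tX + X²) = 1 + (2 - t²)X² + X⁴, and 2 - t² = -(u² +
  -- u⁻²) because u u⁻¹ = 1.
  e-evens-∷ : ∀ u us k → let c = e (evens us) in
    e (evens (u ∷ us)) k ≡ c k + - trace₂ u * shift (shift c) k + shift (shift (shift (shift c))) k
  e-evens-∷ u@(unit x x⁻¹ xx⁻¹≡1) us k = begin
    e (evens (u ∷ us)) k  ≡⟨ e-reciprocal u (opposite u ∷ withNegatives us) k ⟩
    quad 1ℚ (trace u) 1ℚ (e (reciprocal (opposite u ∷ withNegatives us))) k
      ≡⟨ quad-cong 1ℚ (trace u) 1ℚ (e-reciprocal (opposite u) (withNegatives us)) k ⟩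
    quad 1ℚ (x + x⁻¹) 1ℚ (quad 1ℚ (- x + - x⁻¹) 1ℚ c) k  ≡⟨ quad-∘ 1ℚ (x + x⁻¹) 1ℚ 1ℚ (- x + - x⁻¹) 1ℚ c k ⟩
    _  ≡⟨ lemma x x⁻¹ (c k) (shift c k) (shift (shift c) k)
            (shift (shift (shift c)) k) (shift (shift (shift (shift c))) k) ⟩
    c k + ((1ℚ + 1ℚ) * (1ℚ - x * x⁻¹) - trace₂ u) * shift (shift c) k + shift (shift (shift (shift c))) k
      ≡⟨ cong (λ p → c k + ((1ℚ + 1ℚ) * (1ℚ - p) - trace₂ u) * shift (shift c) k
                    + shift (shift (shift (shift c))) k) xx⁻¹≡1 ⟩
    _  ≡⟨ cong (λ t → c k + t * shift (shift c) k + shift (shift (shift (shift c))) k) (+-identityˡ (- trace₂ u)) ⟩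
    c k + - trace₂ u * shift (shift c) k + shift (shift (shift (shift c))) k ∎
    where
    open ≡-Reasoning
    c = e (evens us)
    lemma : ∀ x y c₀ c₁ c₂ c₃ c₄ →
      1ℚ * 1ℚ * c₀ + (1ℚ * (- x + - y) + (x + y) * 1ℚ) * c₁ + (1ℚ * 1ℚ + (x + y) * (- x + - y) + 1ℚ * 1ℚ) * c₂
        + ((x + y) * 1ℚ + 1ℚ * (- x + - y)) * c₃ + 1ℚ * 1ℚ * c₄ ≡
      c₀ + ((1ℚ + 1ℚ) * (1ℚ - x * y) - (x * x + y * y)) * c₂ + c₄
    lemma = solve-∀ ℚ-ring

module _ {c d : ℕ → ℚ} where
  -- Two shifts keep the parity of the index, so on the even coefficients they act as a single
  -- shift.
  shift²-double : (∀ k → c (double k) ≡ d k) → ∀ k → shift (shift c) (double k) ≡ shift d k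
  shift²-double eq zero    = refl
  shift²-double eq (suc k) = eq k

  shift²-1+double : (∀ k → c (suc (double k)) ≡ 0ℚ) → ∀ k → shift (shift c) (suc (double k)) ≡ 0ℚ
  shift²-1+double eq zero    = refl
  shift²-1+double eq (suc k) = eq k

e-evens-double : ∀ us k → e (evens us) (double k) ≡ K us k
e-evens-double []       zero    = refl
e-evens-double []       (suc k) = refl
e-evens-double (u ∷ us) k = begin
  e (evens (u ∷ us)) (double k)  ≡⟨ e-evens-∷ u us (double k) ⟩
  _ ≡⟨ cong₂ _+_ (cong₂ (λ s t → s + - trace₂ u * t) (ih k) (shift²-double ih k))
        (shift²-double {d = shift (K us)} (shift²-double ih) k) ⟩
  K us k + - trace₂ u * shift (K us) k + shift (shift (K us)) k
    ≡⟨ lemma (- trace₂ u) (K us k) (shift (K us) k) (shift (shift (K us)) k) ⟩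
  K (u ∷ us) k ∎
  where
  open ≡-Reasoning
  ih = e-evens-double us
  lemma : ∀ t c₀ c₁ c₂ → c₀ + t * c₁ + c₂ ≡ 1ℚ * c₀ + t * c₁ + 1ℚ * c₂
  lemma = solve-∀ ℚ-ring

e-evens-1+double : ∀ us k → e (evens us) (suc (double k)) ≡ 0ℚ
e-evens-1+double []       k = refl
e-evens-1+double (u ∷ us) k = begin
  e (evens (u ∷ us)) (suc (double k))  ≡⟨ e-evens-∷ u us (suc (double k)) ⟩
  _ ≡⟨ cong₂ _+_ (cong₂ (λ s t → s + - trace₂ u * t) (ih k) (shift²-1+double {d = K us} ih k))
        (shift²-1+double {d = K us} (shift²-1+double {d = K us} ih) k) ⟩
  0ℚ + - trace₂ u * 0ℚ + 0ℚ  ≡⟨ lemma (- trace₂ u) ⟩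
  0ℚ ∎
  where
  open ≡-Reasoning
  ih = e-evens-1+double us
  lemma : ∀ t → 0ℚ + t * 0ℚ + 0ℚ ≡ 0ℚ
  lemma = solve-∀ ℚ-ring

-- Infinitely many units and traces.

a-b≡0⇒a≡b : ∀ {a b} → a - b ≡ 0ℚ → a ≡ b
a-b≡0⇒a≡b {a} {b} = IntegralDomain.x∙y⁻¹≈ε⇒x≈y ℚ-integralDomain a b

a≡b⇒a-b≡0 : ∀ {a b} → a ≡ b → a - b ≡ 0ℚ
a≡b⇒a-b≡0 = IntegralDomain.x≈y⇒x∙y⁻¹≈ε ℚ-integralDomain

inverse-unique : ∀ u {x} → x * val u ≡ 1ℚ → x ≡ inv u
inverse-unique (unit y y⁻¹ yy⁻¹≡1) {x} xy≡1 = begin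
  x              ≡⟨ *-identityʳ x ⟨
  x * 1ℚ         ≡⟨ cong (x *_) yy⁻¹≡1 ⟨
  x * (y * y⁻¹)  ≡⟨ *-assoc x y y⁻¹ ⟨
  x * y * y⁻¹    ≡⟨ cong (_* y⁻¹) xy≡1 ⟩
  1ℚ * y⁻¹       ≡⟨ *-identityˡ y⁻¹ ⟩
  y⁻¹            ∎
  where open ≡-Reasoning

-- Units are compared by value only, since the value determines the inverse.
Unitˢ : Setoid _ _
Unitˢ = On.setoid (≡.setoid ℚ) val

open Membership Unitˢ using () renaming (_∈_ to _∈ᵘ_)

infinite-units>1 : Infinite Unitˢ (λ u → 1ℚ < val u)
infinite-units>1 = infinite-image {S = ≡.setoid ℚ} {S′ = Unitˢ} (λ u v → val u ≟ val v)
  (λ x 1<x → mkUnit x (≢-sym (<⇒≢ (<-trans (positive⁻¹ 1ℚ) 1<x))))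
  (_∷ []) (λ _ _ x≡y → here (sym x≡y)) id (infinite-ℚ 1ℚ)

infinite-units : Infinite Unitˢ (λ _ → ⊤)
infinite-units = infinite-⊆ {S = Unitˢ} (λ _ → tt) infinite-units>1

-- For values x and y with the same trace, (y - x)(yx - 1) = yx((y + y⁻¹) - (x + x⁻¹)) = 0.
trace-fibre : ∀ u v → trace u ≡ trace v → val v ≡ val u ⊎ val v ≡ inv u
trace-fibre u@(unit x x⁻¹ xx⁻¹≡1) (unit y y⁻¹ yy⁻¹≡1) eq =
  Sum.map a-b≡0⇒a≡b (inverse-unique u ∘ a-b≡0⇒a≡b) (zero-product [y-x][yx-1]≡0)
  where
  open ≡-Reasoning
  lemma : ∀ x x⁻¹ y y⁻¹ → (y - x) * (y * x - 1ℚ) ≡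
    y * x * ((y + y⁻¹) - (x + x⁻¹)) - (x * (y * y⁻¹ - 1ℚ) - y * (x * x⁻¹ - 1ℚ))
  lemma = solve-∀ ℚ-ring
  lemma₀ : ∀ x y → y * x * 0ℚ - (x * 0ℚ - y * 0ℚ) ≡ 0ℚ
  lemma₀ = solve-∀ ℚ-ring
  [y-x][yx-1]≡0 : (y - x) * (y * x - 1ℚ) ≡ 0ℚ
  [y-x][yx-1]≡0 = begin
    (y - x) * (y * x - 1ℚ)
      ≡⟨ lemma x x⁻¹ y y⁻¹ ⟩
    y * x * ((y + y⁻¹) - (x + x⁻¹)) - (x * (y * y⁻¹ - 1ℚ) - y * (x * x⁻¹ - 1ℚ))
      ≡⟨ cong₂ _-_ (cong (y * x *_) (a≡b⇒a-b≡0 (sym eq)))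
           (cong₂ (λ s t → x * (s - 1ℚ) - y * (t - 1ℚ)) yy⁻¹≡1 xx⁻¹≡1) ⟩
    y * x * 0ℚ - (x * 0ℚ - y * 0ℚ) ≡⟨ lemma₀ x y ⟩
    0ℚ ∎

infixl 7 _⊛_
_⊛_ : Unit → Unit → Unit
unit x x⁻¹ xx⁻¹≡1 ⊛ unit y y⁻¹ yy⁻¹≡1 = unit (x * y) (x⁻¹ * y⁻¹)
  (trans (lemma x x⁻¹ y y⁻¹) (trans (cong₂ _*_ xx⁻¹≡1 yy⁻¹≡1) (*-identityˡ 1ℚ)))
  where
  lemma : ∀ x x⁻¹ y y⁻¹ → x * y * (x⁻¹ * y⁻¹) ≡ x * x⁻¹ * (y * y⁻¹)
  lemma = solve-∀ ℚ-ring

square-fibre : ∀ x y → y * y ≡ x * x → y ≡ x ⊎ y ≡ - x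
square-fibre x y eq = Sum.map a-b≡0⇒a≡b a-b≡0⇒a≡b (zero-product (trans (lemma x y) (a≡b⇒a-b≡0 eq)))
  where
  lemma : ∀ x y → (y - x) * (y - - x) ≡ y * y - x * x
  lemma = solve-∀ ℚ-ring

infinite-trace : ∀ {P : Unit → Set} → Infinite Unitˢ P →
  Infinite (≡.setoid ℚ) (λ z → ∃[ u ] (P u × trace u ≡ z))
infinite-trace = infinite-image {S = Unitˢ} {S′ = ≡.setoid ℚ} _≟_ (λ u _ → trace u)
  (λ u → u ∷ flip u ∷ []) (λ {u} {v} _ _ eq → [ here , there ∘ here ]′ (trace-fibre u v eq))
  (λ {u} pu → u , pu , refl)

-- `trace₂ u` is the trace of `u ⊛ u`, so equal values force v² = u² or v² = u⁻², which leaves four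
-- candidates for v.
infinite-trace₂ : Infinite (≡.setoid ℚ) (λ z → ∃[ u ] trace₂ u ≡ z)
infinite-trace₂ = infinite-image {S = Unitˢ} {S′ = ≡.setoid ℚ} _≟_ (λ u _ → trace₂ u)
  (λ u → u ∷ opposite u ∷ flip u ∷ opposite (flip u) ∷ [])
  (λ {u} {v} → fib {u} {v}) (λ {u} _ → u , refl) infinite-units
  where
  fib : ∀ {u v} → ⊤ → ⊤ → trace₂ u ≡ trace₂ v → v ∈ᵘ (u ∷ opposite u ∷ flip u ∷ opposite (flip u) ∷ [])
  fib {u} {v} _ _ eq =
    [ [ here , there ∘ here ]′ ∘ square-fibre (val u) (val v)
    , there ∘ there ∘ [ here , there ∘ here ]′ ∘ square-fibre (inv u) (val v)
    ]′ (trace-fibre (u ⊛ u) (v ⊛ v) eq)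

-- Generic choice of the quadruples.

-- A linear combination of neighbouring coefficients is affine in `trace₂ u` for the `u` added last.
-- Genericity rests on this.
K-∷ : ∀ u us x y w k → quad x y w (K (u ∷ us)) k ≡
  quad x y w (K us) k - trace₂ u * shift (quad x y w (K us)) k + shift (shift (quad x y w (K us))) k
K-∷ u us x y w k = trans (quad-comm x y w 1ℚ (- trace₂ u) 1ℚ (K us) k)
  (lemma (trace₂ u) (quad x y w (K us) k) (shift (quad x y w (K us)) k) (shift (shift (quad x y w (K us))) k))
  where
  lemma : ∀ t c₀ c₁ c₂ → 1ℚ * c₀ + - t * c₁ + 1ℚ * c₂ ≡ c₀ - t * c₁ + c₂
  lemma = solve-∀ ℚ-ring

-- A triple stands for the functional x K(k) + y K(k - 1) + w K(k - 2). Each case of the theorem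
-- needs certain of these to be nonzero.
Weights : Set
Weights = ℚ × ℚ × ℚ

weigh : Weights → (ℕ → ℚ) → ℕ → ℚ
weigh (x , y , w) = quad x y w

affine-nonzero : ∀ a b → a ≢ 0ℚ ⊎ b ≢ 0ℚ → ∃[ z ] (∀ t → t ≢ z → a - t * b ≢ 0ℚ)
affine-nonzero a b h with b ≟ 0ℚ
... | no b≢0 = a * inv b′ , λ t t≢ a-tb≡0 → t≢ (begin
  t                    ≡⟨ *-identityʳ t ⟨
  t * 1ℚ               ≡⟨ cong (t *_) (val*inv≡1 b′) ⟨
  t * (b * inv b′)     ≡⟨ *-assoc t b (inv b′) ⟨
  t * b * inv b′       ≡⟨ cong (_* inv b′) (a-b≡0⇒a≡b {a} {t * b} a-tb≡0) ⟨
  a * inv b′ ∎)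
  where
  open ≡-Reasoning
  b′ = mkUnit b b≢0
-- A nonzero constant has no root to exclude; `0ℚ` is a default value.
affine-nonzero a b (inj₁ a≢0) | yes b≡0 = 0ℚ , λ t _ a-tb≡0 → a≢0 (begin
  a               ≡⟨ lemma a t ⟩
  a - t * 0ℚ      ≡⟨ cong (λ z → a - t * z) b≡0 ⟨
  a - t * b       ≡⟨ a-tb≡0 ⟩
  0ℚ ∎)
  where
  open ≡-Reasoning
  lemma : ∀ a t → a ≡ a - t * 0ℚ
  lemma = solve-∀ ℚ-ring
affine-nonzero a b (inj₂ b≢0) | yes b≡0 = ⊥-elim (b≢0 b≡0)

module _ where
  private
    open Membership (≡.setoid ℚ) using (_∉_)

    coefficient : List Unit → ℕ → Weights → ℚ
    coefficient us k ws = weigh ws (K us) k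

    swap-lemma : ∀ c₀ t c₁ c₂ → c₀ - t * c₁ + c₂ ≡ (c₀ + c₂) - t * c₁
    swap-lemma = solve-∀ ℚ-ring

    -- As an affine function of `trace₂ u`, the coefficient for `u ∷ us` is not identically zero:
    -- its constant term or its slope is nonzero.
    Extendable : List Unit → ℕ → Weights → Set
    Extendable us k ws =
      coefficient us k ws + shift (shift (weigh ws (K us))) k ≢ 0ℚ ⊎ shift (weigh ws (K us)) k ≢ 0ℚ

    -- Each triple of weights excludes at most one value of `trace₂ u`, and infinitely many values
    -- are available.
    extend : ∀ us k wss → All (Extendable us k) wss →
      ∃[ u ] All (λ ws → coefficient (u ∷ us) k ws ≢ 0ℚ) wss
    extend us k wss hs with exceptions wss hs
      where
      exceptions : ∀ wss → All (Extendable us k) wss →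
        ∃[ zs ] (∀ u → trace₂ u ∉ zs → All (λ ws → coefficient (u ∷ us) k ws ≢ 0ℚ) wss)
      exceptions []         []       = [] , λ _ _ → []
      exceptions (ws@(x , y , w) ∷ wss) (h ∷ hs)
        with affine-nonzero (coefficient us k ws + shift (shift (weigh ws (K us))) k)
               (shift (weigh ws (K us)) k) h
           | exceptions wss hs
      ... | z , nz | zs , nzs = z ∷ zs , λ u u∉ →
        (λ eq → nz (trace₂ u) (u∉ ∘ here)
           (trans (sym (trans (K-∷ u us x y w k)
             (swap-lemma (coefficient us k ws) (trace₂ u) (shift (weigh ws (K us)) k) _))) eq))
        ∷ nzs u (u∉ ∘ there)
    ... | zs , nzs = let (z , (u , tr≡z) , z∉) = infinite-trace₂ zs in
      u , nzs u (subst (_∉ zs) (sym tr≡z) z∉)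

  -- Induction on the number of quadruples. The slope at index l + 2 is the coefficient at l + 1 for
  -- one quadruple fewer; at index 1 the constant term is the coefficient at 1 for one quadruple
  -- fewer. Without quadruples the series is 1 and its weighted coefficient at 1 is `y`.
  K-nonvanishing : ∀ wss → All (λ (x , y , w) → y ≢ 0ℚ) wss → ∀ {m l} → l ℕ.≤ m →
    ∃[ us ] (length us ≡ m × All (λ ws → weigh ws (K us) (suc l) ≢ 0ℚ) wss)
  K-nonvanishing wss ys≢0 {zero} {zero} z≤n = [] , refl , All.map
    (λ { {x , y , w} y≢0 eq → y≢0 (trans (lemma x y w) eq) }) ys≢0
    where
    lemma : ∀ x y w → y ≡ x * 0ℚ + y * 1ℚ + w * 0ℚ
    lemma = solve-∀ ℚ-ring
  K-nonvanishing wss ys≢0 {suc m} {zero} z≤n =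
    let us , len , nz = K-nonvanishing wss ys≢0 {m} {zero} z≤n
        u , nz′ = extend us 1 wss (All.map (λ c≢0 → inj₁ (c≢0 ∘ trans (sym (+-identityʳ _)))) nz)
    in u ∷ us , cong suc len , nz′
  K-nonvanishing wss ys≢0 {suc m} {suc l} (s≤s l≤m) =
    let us , len , nz = K-nonvanishing wss ys≢0 l≤m
        u , nz′ = extend us (suc (suc l)) wss (All.map inj₂ nz)
    in u ∷ us , cong suc len , nz′

-- From families of rational lists to `NonzeroManySolutions`.

infinite-affine : ∀ {P : ℚ → Set} p {q} → q ≢ 0ℚ → Infinite (≡.setoid ℚ) P →
  Infinite (≡.setoid ℚ) (λ a → ∃[ t ] (P t × p + q * t ≡ a))
infinite-affine p {q} q≢0 = infinite-image {S = ≡.setoid ℚ} {S′ = ≡.setoid ℚ} _≟_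
  (λ t _ → p + q * t) (_∷ [])
  (λ {s} {t} _ _ eq → here (IntegralDomain.*-cancelʳ-≉0 ℚ-integralDomain q≢0
    (trans (*-comm t q) (trans (+-cancelˡ p (q * t) (q * s) (sym eq)) (*-comm q s)))))
  (λ {t} pt → t , pt , refl)
  where open GroupProperties +-0-group using () renaming (∙-cancelˡ to +-cancelˡ)

nonzero-many : ∀ {P : ℚ → Set} i n → (∀ {a} → P a → ManySolutions i n a) →
  Infinite (≡.setoid ℚ) P → NonzeroManySolutions i n
nonzero-many i n many = infinite-⊆ {S = ≡.setoid ℚ} (λ (pa , a∉0) → a∉0 ∘ here , many pa)
  ∘ infinite-avoid {S = ≡.setoid ℚ} (0ℚ ∷ [])

many-units : ∀ i n {a} (f : Unit → List ℚ) → (∀ {u v} → f u ≡ f v → val v ≡ val u) →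
  (∀ u → IsSolution i n a (f u)) → ManySolutions i n a
many-units i n f inj sol = infinite-image {S = Unitˢ} {S′ = ≡.setoid (List ℚ)} (≡-dec _≟_)
  (λ u _ → f u) (_∷ []) (λ _ _ eq → here (inj eq)) (λ {u} _ → sol u) infinite-units

double≡2* : ∀ n → double n ≡ 2 ℕ.* n
double≡2* zero    = refl
double≡2* (suc n) = cong suc (trans (cong suc (double≡2* n)) (sym (ℕ.+-suc n (n ℕ.+ 0))))

solution : ∀ n {i a xs} → length xs ≡ double n → e xs i ≡ a → e xs (double n ℕ.∸ i) ≡ a →
  e xs (double n) ≡ 1ℚ → IsSolution i n a xs
solution n {i} {a} {xs} len eᵢ e₂ₙ₋ᵢ e₂ₙ = subst
  (λ 2n → length xs ≡ 2n × e xs i ≡ a × e xs (2n ℕ.∸ i) ≡ a × e xs 2n ≡ 1ℚ)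
  (double≡2* n) (len , eᵢ , e₂ₙ₋ᵢ , e₂ₙ)

-- Only the equation for `i` has to be checked: the one for 2n - i follows by the palindromic
-- symmetry, and the product of all the numbers is 1.
reciprocal-solution : ∀ us {i n a} → length us ≡ n → i ℕ.≤ double n → e (reciprocal us) i ≡ a →
  IsSolution i n a (reciprocal us)
reciprocal-solution us {i} {n} refl i≤2n eᵢ = solution n {i} (length-reciprocal us) eᵢ
  (trans (e-palindromic us (double n ℕ.∸ i) i (ℕ.m∸n+n≡m i≤2n)) eᵢ) (e-top us)

-- One `u` stays free, and the value is affine in `trace₂ u` with slope `- q`. The weights (0, x, y)
-- at index l + 1 are the weights (x, y, 0) at index l, so a generic `us` makes `q` nonzero.
K-infinite : ∀ x y → x ≢ 0ℚ → ∀ {m l} → l ℕ.≤ m → ∃[ us ] (length us ≡ m ×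
  Infinite (≡.setoid ℚ) (λ a → ∃[ u ] quad x y 0ℚ (K (u ∷ us)) (suc l) ≡ a))
K-infinite x y x≢0 {l = l} l≤m =
  let us , len , nz = K-nonvanishing ((0ℚ , x , y) ∷ []) (x≢0 ∷ []) l≤m
      q             = quad x y 0ℚ (K us) l
      p             = quad x y 0ℚ (K us) (suc l) + shift (quad x y 0ℚ (K us)) l
      q≢0           = All.head nz ∘ trans (lemma₁ x y (K us (suc l)) (K us l) (shift (K us) l) (shift (shift (K us)) l)) ∘ lemma₂ q
  in us , len , infinite-⊆ {S = ≡.setoid ℚ}
       (λ { (_ , (u , refl) , refl) → u , trans (K-∷ u us x y 0ℚ (suc l))
            (lemma₃ (quad x y 0ℚ (K us) (suc l)) (trace₂ u) q (shift (quad x y 0ℚ (K us)) l)) })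
       (infinite-affine p q≢0 infinite-trace₂)
  where
  lemma₁ : ∀ x y c₀ c₁ c₂ c₃ → 0ℚ * c₀ + x * c₁ + y * c₂ ≡ x * c₁ + y * c₂ + 0ℚ * c₃
  lemma₁ = solve-∀ ℚ-ring
  lemma₂ : ∀ q → - q ≡ 0ℚ → q ≡ 0ℚ
  lemma₂ q = neg-injective {q} {0ℚ}
  lemma₃ : ∀ a t b c → a - t * b + c ≡ a + c + - b * t
  lemma₃ = solve-∀ ℚ-ring

shift-double : ∀ {c : ℕ → ℚ} → (∀ k → c (suc (double k)) ≡ 0ℚ) → ∀ k → shift c (double k) ≡ 0ℚ
shift-double eq zero    = refl
shift-double eq (suc k) = eq k

n≤double : ∀ n → n ℕ.≤ double n
n≤double zero    = z≤n
n≤double (suc n) = s≤s (ℕ.m≤n⇒m≤1+n (n≤double n))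

-- The cases with `i` even.

module EvenEven where
  -- Write z′ for this number, so z z′ = -u⁻². Then u, -u, z, z′ have the generating polynomial (1 -
  -- u²X²)(1 + (z + z′)X - u⁻²X²). Its even part 1 - (u² + u⁻²)X² + X⁴ is that of a quadruple and
  -- does not involve z.
  inverse-square : Unit → Unit → ℚ
  inverse-square u z = - (inv u * inv u) * inv z

  roots : Unit → List Unit → Unit → List ℚ
  roots u us z = val u ∷ - val u ∷ val z ∷ inverse-square u z ∷ evens us

  e-roots : ∀ u us z k → e (roots u us z) (double k) ≡ K (u ∷ us) k
  e-roots u@(unit x x⁻¹ xx⁻¹≡1) us z@(unit y y⁻¹ yy⁻¹≡1) k = begin
    e (roots u us z) (double k)
      ≡⟨ e-∷-∷ x (- x) (y ∷ y′ ∷ evens us) (double k) ⟩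
    quad 1ℚ (x + - x) (x * - x) (e (y ∷ y′ ∷ evens us)) (double k)
      ≡⟨ quad-cong 1ℚ (x + - x) (x * - x) (e-∷-∷ y y′ (evens us)) (double k) ⟩
    quad 1ℚ (x + - x) (x * - x) (quad 1ℚ (y + y′) (y * y′) c) (double k)
      ≡⟨ quad-∘ 1ℚ (x + - x) (x * - x) 1ℚ (y + y′) (y * y′) c (double k) ⟩
    poly (c (double k)) (shift c (double k)) (shift (shift c) (double k))
      (shift (shift (shift c)) (double k)) (shift (shift (shift (shift c))) (double k))
      ≡⟨ cong₂ (λ c₁ c₃ → poly (c (double k)) c₁ (shift (shift c) (double k)) c₃
                             (shift (shift (shift (shift c))) (double k)))
           (shift-double odd k) (shift-double (shift²-1+double {d = K us} odd) k) ⟩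
    poly (c (double k)) 0ℚ (shift (shift c) (double k)) 0ℚ (shift (shift (shift (shift c))) (double k))
      ≡⟨ cong₂ (λ c₀ f → f c₀) (even k) (cong₂ (λ c₂ c₄ c₀ → poly c₀ 0ℚ c₂ 0ℚ c₄) (shift²-double even k)
           (shift²-double {d = shift (K us)} (shift²-double even) k)) ⟩
    poly k₀ 0ℚ k₁ 0ℚ k₂
      ≡⟨ lemma x x⁻¹ y y⁻¹ k₀ k₁ k₂ ⟩
    k₀ + - (x⁻¹ * x⁻¹ * (y * y⁻¹) + x * x) * k₁ + x * x⁻¹ * (x * x⁻¹) * (y * y⁻¹) * k₂
      ≡⟨ cong₂ (λ s t → k₀ + - (x⁻¹ * x⁻¹ * t + x * x) * k₁ + s * s * t * k₂) xx⁻¹≡1 yy⁻¹≡1 ⟩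
    k₀ + - (x⁻¹ * x⁻¹ * 1ℚ + x * x) * k₁ + 1ℚ * 1ℚ * 1ℚ * k₂ ≡⟨ lemma′ x x⁻¹ k₀ k₁ k₂ ⟩
    K (u ∷ us) k ∎
    where
    open ≡-Reasoning
    c   = e (evens us)
    y′  = inverse-square u z
    odd = e-evens-1+double us
    even = e-evens-double us
    k₀ = K us k
    k₁ = shift (K us) k
    k₂ = shift (shift (K us)) k
    poly : ℚ → ℚ → ℚ → ℚ → ℚ → ℚ
    poly c₀ c₁ c₂ c₃ c₄ = 1ℚ * 1ℚ * c₀ + (1ℚ * (y + y′) + (x + - x) * 1ℚ) * c₁
      + (1ℚ * (y * y′) + (x + - x) * (y + y′) + x * - x * 1ℚ) * c₂
      + ((x + - x) * (y * y′) + x * - x * (y + y′)) * c₃ + x * - x * (y * y′) * c₄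
    lemma : ∀ x x⁻¹ y y⁻¹ c₀ c₂ c₄ → let y′ = - (x⁻¹ * x⁻¹) * y⁻¹ in
      1ℚ * 1ℚ * c₀ + (1ℚ * (y + y′) + (x + - x) * 1ℚ) * 0ℚ
      + (1ℚ * (y * y′) + (x + - x) * (y + y′) + x * - x * 1ℚ) * c₂
      + ((x + - x) * (y * y′) + x * - x * (y + y′)) * 0ℚ + x * - x * (y * y′) * c₄ ≡
      c₀ + - (x⁻¹ * x⁻¹ * (y * y⁻¹) + x * x) * c₂ + x * x⁻¹ * (x * x⁻¹) * (y * y⁻¹) * c₄
    lemma = solve-∀ ℚ-ring
    lemma′ : ∀ x x⁻¹ c₀ c₂ c₄ → c₀ + - (x⁻¹ * x⁻¹ * 1ℚ + x * x) * c₂ + 1ℚ * 1ℚ * 1ℚ * c₄ ≡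
      1ℚ * c₀ + - (x * x + x⁻¹ * x⁻¹) * c₂ + 1ℚ * c₄
    lemma′ = solve-∀ ℚ-ring

  -- The list `roots` is in general not closed under inversion. The symmetry of its even
  -- coefficients is read off from `evens`, which shares them.
  K-palindromic : ∀ us a b → a ℕ.+ b ≡ double (length us) → K us a ≡ K us b
  K-palindromic us a b eq = begin
    K us a                   ≡⟨ e-evens-double us a ⟨
    e (evens us) (double a)  ≡⟨ e-palindromic (withNegatives us) (double a) (double b) (begin
      double a ℕ.+ double b    ≡⟨ double-+ a b ⟨
      double (a ℕ.+ b)         ≡⟨ cong double eq ⟩
      double (double (length us)) ≡⟨ cong double (length-withNegatives us) ⟨
      double (length (withNegatives us)) ∎) ⟩
    e (evens us) (double b)  ≡⟨ e-evens-double us b ⟩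
    K us b ∎
    where
    open ≡-Reasoning
    double-+ : ∀ a b → double (a ℕ.+ b) ≡ double a ℕ.+ double b
    double-+ zero    b = refl
    double-+ (suc a) b = cong (suc ∘ suc) (double-+ a b)

  double-∸ : ∀ m n → double m ℕ.∸ double n ≡ double (m ℕ.∸ n)
  double-∸ m       zero    = refl
  double-∸ zero    (suc n) = refl
  double-∸ (suc m) (suc n) = double-∸ m n

  roots-solution : ∀ u us z {j m a} → length us ≡ m → j ℕ.≤ double (suc m) → K (u ∷ us) j ≡ a →
    IsSolution (double j) (double (suc m)) a (roots u us z)
  roots-solution u us z {j} refl j≤n refl = solution (double (suc (length us))) {double j}
    (cong (suc ∘ suc ∘ suc ∘ suc)
      (trans (length-reciprocal (withNegatives us)) (cong double (length-withNegatives us))))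
    (e-roots u us z j)
    (trans (cong (e (roots u us z)) (double-∸ (double (suc (length us))) j))
      (trans (e-roots u us z (double (suc (length us)) ℕ.∸ j)) (K-palindromic (u ∷ us) _ j (ℕ.m∸n+n≡m j≤n))))
    (trans (e-roots u us z (double (suc (length us))))
      (trans (K-palindromic (u ∷ us) _ 0 (ℕ.+-identityʳ _)) (sym (e-evens-double (u ∷ us) 0))))

  nonzero-many-even-even : ∀ j m → j ℕ.≤ m → NonzeroManySolutions (double (suc j)) (double (suc m))
  nonzero-many-even-even j m j≤m =
    let us , len , inf = K-infinite 1ℚ 0ℚ (λ ()) j≤m
    in nonzero-many (double (suc j)) (double (suc m))
      (λ { (u , refl) → many-units (double (suc j)) (double (suc m)) (roots u us)
        (λ eq → sym (∷-injectiveˡ (∷-injectiveʳ (∷-injectiveʳ eq))))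
        λ z → roots-solution u us z len (s≤s (ℕ.m≤n⇒m≤1+n (ℕ.≤-trans j≤m (n≤double m))))
          (lemma (K (u ∷ us) (suc j)) (K (u ∷ us) j) (shift (K (u ∷ us)) j)) }) inf
    where
    lemma : ∀ c₀ c₁ c₂ → c₀ ≡ 1ℚ * c₀ + 0ℚ * c₁ + 0ℚ * c₂
    lemma = solve-∀ ℚ-ring

double-mono : ∀ {m n} → m ℕ.≤ n → double m ℕ.≤ double n
double-mono z≤n     = z≤n
double-mono (s≤s h) = s≤s (s≤s (double-mono h))

-- The middle term of 1 + (z + z⁻¹)X + X² only affects odd coefficients, so `σᵢ` is K(j + 1) + K(j)
-- for every z.
nonzero-many-even-odd : ∀ j m → j ℕ.≤ m → NonzeroManySolutions (double (suc j)) (suc (double (suc m)))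
nonzero-many-even-odd j m j≤m =
  let us , len , inf = K-infinite 1ℚ 1ℚ (λ ()) j≤m
  in nonzero-many (double (suc j)) (suc (double (suc m)))
      (λ { (u , refl) → many-units (double (suc j)) (suc (double (suc m)))
        (λ z → reciprocal (z ∷ withNegatives (u ∷ us))) (sym ∘ ∷-injectiveˡ)
        λ z → reciprocal-solution (z ∷ withNegatives (u ∷ us))
          (cong suc (trans (length-withNegatives (u ∷ us)) (cong (double ∘ suc) len)))
          (double-mono (s≤s (ℕ.≤-trans j≤m (ℕ.≤-trans (n≤double m) (ℕ.m≤n+m _ 2)))))
          (begin
            e (reciprocal (z ∷ withNegatives (u ∷ us))) (double (suc j))
              ≡⟨ e-reciprocal z (withNegatives (u ∷ us)) (double (suc j)) ⟩
            quad 1ℚ (trace z) 1ℚ (e (evens (u ∷ us))) (double (suc j))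
              ≡⟨ cong₂ _+_ (cong₂ (λ s t → 1ℚ * s + trace z * t)
                          (e-evens-double (u ∷ us) (suc j)) (e-evens-1+double (u ∷ us) j))
                   (cong (1ℚ *_) (e-evens-double (u ∷ us) j)) ⟩
            1ℚ * K (u ∷ us) (suc j) + trace z * 0ℚ + 1ℚ * K (u ∷ us) j
              ≡⟨ lemma (trace z) (K (u ∷ us) (suc j)) (K (u ∷ us) j) (shift (K (u ∷ us)) j) ⟩
            quad 1ℚ 1ℚ 0ℚ (K (u ∷ us)) (suc j) ∎) })
      inf
  where
  open ≡-Reasoning
  lemma : ∀ t c₀ c₁ c₂ → 1ℚ * c₀ + t * 0ℚ + 1ℚ * c₁ ≡ 1ℚ * c₀ + 1ℚ * c₁ + 0ℚ * c₂
  lemma = solve-∀ ℚ-ring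

-- The case `i = 1`, `n` odd.

-- Every quadruple has sum zero, so `σ₁` equals `trace z`, while the `u` of one quadruple
-- parametrises the solutions.
nonzero-many-1-odd : ∀ m → NonzeroManySolutions 1 (suc (double (suc m)))
nonzero-many-1-odd m = nonzero-many 1 (suc (double (suc m))) (λ { (z , _ , refl) →
  many-units 1 (suc (double (suc m))) (roots z)
    (λ eq → sym (∷-injectiveˡ (∷-injectiveʳ (∷-injectiveʳ eq)))) λ u →
    reciprocal-solution (z ∷ withNegatives (u ∷ us))
      (cong suc (trans (length-withNegatives (u ∷ us)) (cong (double ∘ suc) (length-replicate m)))) (s≤s z≤n)
      (trans (e-reciprocal z (withNegatives (u ∷ us)) 1)
        (trans (cong (λ t → 1ℚ * t + trace z * 1ℚ + 1ℚ * 0ℚ) (e-evens-1+double (u ∷ us) 0)) (lemma (trace z)))) })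
  (infinite-trace infinite-units)
  where
  us : List Unit
  us = replicate m (unit 1ℚ 1ℚ refl)
  roots : Unit → Unit → List ℚ
  roots z u = reciprocal (z ∷ withNegatives (u ∷ us))
  lemma : ∀ t → 1ℚ * 0ℚ + t * 1ℚ + 1ℚ * 0ℚ ≡ t
  lemma = solve-∀ ℚ-ring

2ℚ 4ℚ 8ℚ : ℚ
2ℚ = 1ℚ + 1ℚ
4ℚ = 2ℚ + 2ℚ
8ℚ = 4ℚ + 4ℚ

-- The circle construction

0≤x² : ∀ x → 0ℚ ℚ.≤ x * x
0≤x² x =
  [ (λ 0≤x → nonNegative⁻¹ (x * x) {{nonNeg*nonNeg⇒nonNeg x {{nonNegative 0≤x}} x {{nonNegative 0≤x}}}})
  , (λ x≤0 → nonNegative⁻¹ (x * x) {{nonPos*nonPos⇒nonPos x {{nonPositive x≤0}} x {{nonPositive x≤0}}}})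
  ]′ (≤-total 0ℚ x)

x<y+z² : ∀ {x y} z → x < y → x < y + z * z
x<y+z² {x} {y} z x<y = <-≤-trans x<y (subst (ℚ._≤ y + z * z) (+-identityʳ y) (+-monoʳ-≤ y (0≤x² z)))

1+x²≢0 : ∀ x → 1ℚ + x * x ≢ 0ℚ
1+x²≢0 x = ≢-sym (<⇒≢ (x<y+z² x (positive⁻¹ 1ℚ)))

module Cayley (m : ℚ) (m-1≢0 : m - 1ℚ ≢ 0ℚ) (m+1≢0 : m + 1ℚ ≢ 0ℚ) where
  private
    p q : Unit
    p = mkUnit (m - 1ℚ) m-1≢0
    q = mkUnit (m + 1ℚ) m+1≢0

  -- The substitution u = (m + 1)/(m - 1), with inverse m = (u + 1)/(u - 1). It gives u + u⁻¹ = 2 +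
  -- 4/(m² - 1), so the trace depends on m² only.
  cayley : Unit
  cayley = unit ((m + 1ℚ) * inv p) ((m - 1ℚ) * inv q)
    (trans (lemma m (inv p) (inv q)) (trans (cong₂ _*_ (val*inv≡1 p) (val*inv≡1 q)) (*-identityˡ 1ℚ)))
    where
    lemma : ∀ m p q → (m + 1ℚ) * p * ((m - 1ℚ) * q) ≡ (m - 1ℚ) * p * ((m + 1ℚ) * q)
    lemma = solve-∀ ℚ-ring

  μ : ℚ
  μ = inv p * inv q

  μ[m²-1]≡1 : μ * (m * m - 1ℚ) ≡ 1ℚ
  μ[m²-1]≡1 = trans (lemma m (inv p) (inv q)) (trans (cong₂ _*_ (val*inv≡1 p) (val*inv≡1 q)) (*-identityˡ 1ℚ))
    where
    lemma : ∀ m p q → p * q * (m * m - 1ℚ) ≡ (m - 1ℚ) * p * ((m + 1ℚ) * q)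
    lemma = solve-∀ ℚ-ring

  trace-cayley : trace cayley ≡ 2ℚ + 4ℚ * μ
  trace-cayley = trans (lemma m (inv p) (inv q)) (trans
    (cong₂ (λ s t → s + t + 2ℚ * inv p * (1ℚ - t) - 2ℚ * inv q * (1ℚ - s) + 4ℚ * μ)
      (val*inv≡1 p) (val*inv≡1 q))
    (lemma′ (inv p) (inv q)))
    where
    lemma : ∀ m p q → (m + 1ℚ) * p + (m - 1ℚ) * q ≡
      (m - 1ℚ) * p + (m + 1ℚ) * q + 2ℚ * p * (1ℚ - (m + 1ℚ) * q) - 2ℚ * q * (1ℚ - (m - 1ℚ) * p) + 4ℚ * (p * q)
    lemma = solve-∀ ℚ-ring
    lemma′ : ∀ p q → 1ℚ + 1ℚ + 2ℚ * p * (1ℚ - 1ℚ) - 2ℚ * q * (1ℚ - 1ℚ) + 4ℚ * (p * q) ≡ 2ℚ + 4ℚ * (p * q)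
    lemma′ = solve-∀ ℚ-ring

  m-from-cayley : (val cayley - 1ℚ) * m ≡ val cayley + 1ℚ
  m-from-cayley = trans (lemma m (inv p)) (trans
    (cong (λ s → (m + 1ℚ) * s - m + (m + 1ℚ) * inv p) (val*inv≡1 p)) (lemma′ m (inv p)))
    where
    lemma : ∀ m p → ((m + 1ℚ) * p - 1ℚ) * m ≡ (m + 1ℚ) * ((m - 1ℚ) * p) - m + (m + 1ℚ) * p
    lemma = solve-∀ ℚ-ring
    lemma′ : ∀ m p → (m + 1ℚ) * 1ℚ - m + (m + 1ℚ) * p ≡ (m + 1ℚ) * p + 1ℚ
    lemma′ = solve-∀ ℚ-ring

  val-cayley≢1 : val cayley - 1ℚ ≢ 0ℚ
  val-cayley≢1 eq = 2≢0 (begin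
    2ℚ  ≡⟨ lemma (val cayley) m ⟩
    val cayley + 1ℚ - (val cayley - 1ℚ)  ≡⟨ cong (_- (val cayley - 1ℚ)) m-from-cayley ⟨
    (val cayley - 1ℚ) * m - (val cayley - 1ℚ) ≡⟨ cong (λ t → t * m - t) eq ⟩
    0ℚ * m - 0ℚ ≡⟨ lemma′ m ⟩
    0ℚ ∎)
    where
    open ≡-Reasoning
    2≢0 : 2ℚ ≢ 0ℚ
    2≢0 ()
    lemma : ∀ x m → 2ℚ ≡ x + 1ℚ - (x - 1ℚ)
    lemma = solve-∀ ℚ-ring
    lemma′ : ∀ m → 0ℚ * m - 0ℚ ≡ 0ℚ
    lemma′ = solve-∀ ℚ-ring

open Cayley using (cayley)

cayley-injective : ∀ m m′ p q p′ q′ → val (cayley m p q) ≡ val (cayley m′ p′ q′) → m ≡ m′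
cayley-injective m m′ p q p′ q′ eq = IntegralDomain.*-cancelʳ-≉0 ℚ-integralDomain (Cayley.val-cayley≢1 m p q) (begin
  m * (val x - 1ℚ)    ≡⟨ *-comm m _ ⟩
  (val x - 1ℚ) * m    ≡⟨ Cayley.m-from-cayley m p q ⟩
  val x + 1ℚ          ≡⟨ cong (_+ 1ℚ) eq ⟩
  val y + 1ℚ          ≡⟨ Cayley.m-from-cayley m′ p′ q′ ⟨
  (val y - 1ℚ) * m′   ≡⟨ cong (λ t → (t - 1ℚ) * m′) eq ⟨
  (val x - 1ℚ) * m′   ≡⟨ *-comm _ m′ ⟩
  m′ * (val x - 1ℚ)   ∎)
  where
  open ≡-Reasoning
  x = cayley m p q
  y = cayley m′ p′ q′

-- The plane tangent to the surface at x = y = 2 cuts out x = 2 + 4/(M - 1), y = 2 + 4/(N - 1)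
-- with M + N = Q⁻¹.
tangent-section : ∀ ρ Q M N μ ν s → μ * (M - 1ℚ) ≡ 1ℚ → ν * (N - 1ℚ) ≡ 1ℚ →
  Q * (M + N) ≡ 1ℚ → s ≡ ρ * (Q - ½) →
  let x = 2ℚ + 4ℚ * μ ; y = 2ℚ + 4ℚ * ν in
  ρ * (x + y + s) + x * y * s ≡ 4ℚ * ρ + (4ℚ + ρ) * s
tangent-section ρ Q M N μ ν _ hμ hν hQ refl = begin
  _ ≡⟨ lemma ρ Q M N μ ν ⟩
  c + 8ℚ * ρ * Q * (μ * (1ℚ - ν * (N - 1ℚ)) + ν * (1ℚ - μ * (M - 1ℚ))) + 8ℚ * ρ * μ * ν * (Q * (M + N) - 1ℚ)
    ≡⟨ cong₂ _+_ (cong₂ (λ s t → c + 8ℚ * ρ * Q * (μ * (1ℚ - t) + ν * (1ℚ - s))) hμ hν)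
         (cong (λ t → 8ℚ * ρ * μ * ν * (t - 1ℚ)) hQ) ⟩
  c + 8ℚ * ρ * Q * (μ * (1ℚ - 1ℚ) + ν * (1ℚ - 1ℚ)) + 8ℚ * ρ * μ * ν * (1ℚ - 1ℚ) ≡⟨ lemma′ c ρ Q μ ν ⟩
  c ∎
  where
  open ≡-Reasoning
  c = 4ℚ * ρ + (4ℚ + ρ) * (ρ * (Q - ½))
  lemma : ∀ ρ Q M N μ ν → let x = 2ℚ + 4ℚ * μ ; y = 2ℚ + 4ℚ * ν ; s = ρ * (Q - ½) in
    ρ * (x + y + s) + x * y * s ≡ 4ℚ * ρ + (4ℚ + ρ) * s
     + 8ℚ * ρ * Q * (μ * (1ℚ - ν * (N - 1ℚ)) + ν * (1ℚ - μ * (M - 1ℚ))) + 8ℚ * ρ * μ * ν * (Q * (M + N) - 1ℚ)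
  lemma = solve-∀ ℚ-ring
  lemma′ : ∀ c ρ Q μ ν → c + 8ℚ * ρ * Q * (μ * (1ℚ - 1ℚ) + ν * (1ℚ - 1ℚ)) + 8ℚ * ρ * μ * ν * (1ℚ - 1ℚ) ≡ c
  lemma′ = solve-∀ ℚ-ring

val≢0 : ∀ u → val u ≢ 0ℚ
val≢0 u val≡0 = 0≢1 (trans (sym (*-zeroˡ (inv u))) (trans (cong (_* inv u) (sym val≡0)) (val*inv≡1 u)))
  where
  0≢1 : 0ℚ ≢ 1ℚ
  0≢1 ()

module Circle (A B : ℚ) (1<B² : 1ℚ < B * B) where
  Q : ℚ
  Q = B * B + A * A

  private
    1<Q : 1ℚ < Q
    1<Q = x<y+z² A 1<B²

    q : Unit
    q = mkUnit Q (≢-sym (<⇒≢ (<-trans (positive⁻¹ 1ℚ) 1<Q)))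

    denominator : ℚ → Unit
    denominator t = mkUnit (1ℚ + t * t) (1+x²≢0 t)

    -- Rational parametrisation of the unit circle, with (1 - t²)/(1 + t²) written as 2/(1 + t²) -
    -- 1.
    cosine sine : ℚ → ℚ
    cosine t = 2ℚ * inv (denominator t) - 1ℚ
    sine   t = 2ℚ * t * inv (denominator t)

  -- The rational point (A/Q, B/Q) of the circle m² + n² = Q⁻¹, rotated by the angle with parameter
  -- `t`.
  m₁ m₂ : ℚ → ℚ
  m₁ t = (A * cosine t - B * sine t) * inv q
  m₂ t = (A * sine t + B * cosine t) * inv q

  on-circle : ∀ t → Q * (m₁ t * m₁ t + m₂ t * m₂ t) ≡ 1ℚ
  on-circle t = trans (lemma A B t (inv (denominator t)) (inv q))
    (trans (cong₂ (λ x y → x * x * (1ℚ + 4ℚ * inv (denominator t) * (y - 1ℚ)))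
             (val*inv≡1 q) (val*inv≡1 (denominator t)))
      (lemma′ (inv (denominator t))))
    where
    lemma : ∀ A B t w q → let
        c = 2ℚ * w - 1ℚ ; s = 2ℚ * t * w ; m = (A * c - B * s) * q ; n = (A * s + B * c) * q in
      (B * B + A * A) * (m * m + n * n) ≡
      (B * B + A * A) * q * ((B * B + A * A) * q) * (1ℚ + 4ℚ * w * ((1ℚ + t * t) * w - 1ℚ))
    lemma = solve-∀ ℚ-ring
    lemma′ : ∀ w → 1ℚ * 1ℚ * (1ℚ + 4ℚ * w * (1ℚ - 1ℚ)) ≡ 1ℚ
    lemma′ = solve-∀ ℚ-ring

  private
    -- As Q > 1 the circle has radius below 1, so no coordinate reaches ±1, where `cayley` is
    -- undefined.
    abscissa≢±1 : ∀ x y → Q * (x * x + y * y) ≡ 1ℚ → x * x ≢ 1ℚ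
    abscissa≢±1 x y eq x²≡1 = <⇒≢ (x<y+z² (A * y) (x<y+z² (B * y) 1<Q)) (begin
      1ℚ                                             ≡⟨ eq ⟨
      Q * (x * x + y * y)                            ≡⟨ cong (λ t → Q * (t + y * y)) x²≡1 ⟩
      Q * (1ℚ + y * y)                               ≡⟨ lemma A B y ⟩
      Q + B * y * (B * y) + A * y * (A * y) ∎)
      where
      open ≡-Reasoning
      lemma : ∀ A B y → (B * B + A * A) * (1ℚ + y * y) ≡ B * B + A * A + B * y * (B * y) + A * y * (A * y)
      lemma = solve-∀ ℚ-ring

    x-1≢0 : ∀ x → x * x ≢ 1ℚ → x - 1ℚ ≢ 0ℚ
    x-1≢0 x x²≢1 x-1≡0 = x²≢1 (cong (λ x → x * x) {x} {1ℚ} (a-b≡0⇒a≡b {x} {1ℚ} x-1≡0))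

    x+1≢0 : ∀ x → x * x ≢ 1ℚ → x + 1ℚ ≢ 0ℚ
    x+1≢0 x x²≢1 x+1≡0 = x²≢1 (cong (λ x → x * x) {x} { - 1ℚ} (a-b≡0⇒a≡b {x} { - 1ℚ} x+1≡0))

    m₁²≢1 : ∀ t → m₁ t * m₁ t ≢ 1ℚ
    m₁²≢1 t = abscissa≢±1 (m₁ t) (m₂ t) (on-circle t)

    m₂²≢1 : ∀ t → m₂ t * m₂ t ≢ 1ℚ
    m₂²≢1 t = abscissa≢±1 (m₂ t) (m₁ t) (trans (cong (Q *_) (+-comm (m₂ t * m₂ t) (m₁ t * m₁ t))) (on-circle t))

    m₁-1≢0 : ∀ t → m₁ t - 1ℚ ≢ 0ℚ
    m₁-1≢0 t = x-1≢0 (m₁ t) (m₁²≢1 t)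
    m₁+1≢0 : ∀ t → m₁ t + 1ℚ ≢ 0ℚ
    m₁+1≢0 t = x+1≢0 (m₁ t) (m₁²≢1 t)
    m₂-1≢0 : ∀ t → m₂ t - 1ℚ ≢ 0ℚ
    m₂-1≢0 t = x-1≢0 (m₂ t) (m₂²≢1 t)
    m₂+1≢0 : ∀ t → m₂ t + 1ℚ ≢ 0ℚ
    m₂+1≢0 t = x+1≢0 (m₂ t) (m₂²≢1 t)

  module M₁ t = Cayley (m₁ t) (m₁-1≢0 t) (m₁+1≢0 t)
  module M₂ t = Cayley (m₂ t) (m₂-1≢0 t) (m₂+1≢0 t)

  -- Rotating back recovers cosine and sine. The cosine gives 1/(1 + t²), and the sine divided by
  -- twice this is `t`.
  points-injective : ∀ s t → m₁ s ≡ m₁ t → m₂ s ≡ m₂ t → s ≡ t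
  points-injective s t eq₁ eq₂ = IntegralDomain.*-cancelʳ-≉0 ℚ-integralDomain 2w≢0 (begin
    s * (2ℚ * w)       ≡⟨ lemma s w ⟩
    sine s             ≡⟨ trans (sym (sine-from s)) (trans (cong₂ (λ x y → A * y - B * x) eq₁ eq₂) (sine-from t)) ⟩
    sine t             ≡⟨ lemma t w′ ⟨
    t * (2ℚ * w′)      ≡⟨ cong (t *_) 2w≡2w′ ⟨
    t * (2ℚ * w) ∎)
    where
    open ≡-Reasoning
    w  = inv (denominator s)
    w′ = inv (denominator t)
    2w≢0 : 2ℚ * w ≢ 0ℚ
    2w≢0 = *-≢0 {2ℚ} (λ ()) (val≢0 (flip (denominator s)))
    lemma : ∀ t w → t * (2ℚ * w) ≡ 2ℚ * t * w
    lemma = solve-∀ ℚ-ring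
    cosine-from : ∀ t → A * m₁ t + B * m₂ t ≡ cosine t
    cosine-from t = trans (lemma₁ A B (cosine t) (sine t) (inv q)) (trans (cong (_* cosine t) (val*inv≡1 q)) (*-identityˡ _))
      where
      lemma₁ : ∀ A B c s q → A * ((A * c - B * s) * q) + B * ((A * s + B * c) * q) ≡ (B * B + A * A) * q * c
      lemma₁ = solve-∀ ℚ-ring
    sine-from : ∀ t → A * m₂ t - B * m₁ t ≡ sine t
    sine-from t = trans (lemma₂ A B (cosine t) (sine t) (inv q)) (trans (cong (_* sine t) (val*inv≡1 q)) (*-identityˡ _))
      where
      lemma₂ : ∀ A B c s q → A * ((A * s + B * c) * q) - B * ((A * c - B * s) * q) ≡ (B * B + A * A) * q * s
      lemma₂ = solve-∀ ℚ-ring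
    2w≡2w′ : 2ℚ * w ≡ 2ℚ * w′
    2w≡2w′ = trans (sym (lemma₃ (2ℚ * w))) (trans (cong (_+ 1ℚ)
      (trans (sym (cosine-from s)) (trans (cong₂ (λ x y → A * x + B * y) eq₁ eq₂) (cosine-from t)))) (lemma₃ (2ℚ * w′)))
      where
      lemma₃ : ∀ x → x - 1ℚ + 1ℚ ≡ x
      lemma₃ = solve-∀ ℚ-ring

  cayleys-injective : ∀ s t → val (M₁.cayley s) ≡ val (M₁.cayley t) →
    val (M₂.cayley s) ≡ val (M₂.cayley t) → s ≡ t
  cayleys-injective s t eq₁ eq₂ = points-injective s t
    (cayley-injective (m₁ s) (m₁ t) (m₁-1≢0 s) (m₁+1≢0 s) (m₁-1≢0 t) (m₁+1≢0 t) eq₁)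
    (cayley-injective (m₂ s) (m₂ t) (m₂-1≢0 s) (m₂+1≢0 s) (m₂-1≢0 t) (m₂+1≢0 t) eq₂)

-- The case of odd `i ≥ 3` and odd `n`.

-- For traces r, s, t the odd part of (1 + rX + X²)(1 + sX + X²)(1 + tX + X²) is (r + s + t)X(1 +
-- X²)² + rstX³.
e-triple : ∀ x y z us j → e (reciprocal (x ∷ y ∷ z ∷ withNegatives us)) (suc (double (suc j))) ≡
  (trace x + trace y + trace z) * quad 1ℚ 2ℚ 1ℚ (K us) (suc j) + trace x * trace y * trace z * K us j
e-triple x y z us j = begin
  e (reciprocal (x ∷ y ∷ z ∷ withNegatives us)) (3+ k)
    ≡⟨ e-reciprocal x (y ∷ z ∷ withNegatives us) (3+ k) ⟩
  quad 1ℚ r 1ℚ (e (reciprocal (y ∷ z ∷ withNegatives us))) (3+ k)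
    ≡⟨ quad-cong 1ℚ r 1ℚ (λ k → trans (e-reciprocal y (z ∷ withNegatives us) k)
         (trans (quad-cong 1ℚ s 1ℚ (e-reciprocal z (withNegatives us)) k) (quad-∘ 1ℚ s 1ℚ 1ℚ t 1ℚ c k))) (3+ k) ⟩
  poly (c (3+ k)) (c (2+ k)) (c (1+ k)) (c k) (shift c k) (shift (shift c) k) (shift (shift (shift c)) k)
    -- All seven coefficients are replaced at once: those of odd index by zero, those of even index
    -- by values of `K us`.
    ≡⟨ cong₂ (λ c₀ f → f c₀) (odd (suc j)) (cong₂ (λ c₁ f c₀ → f c₀ c₁) (even (suc j))
        (cong₂ (λ c₂ f c₀ c₁ → f c₀ c₁ c₂) (odd j) (cong₂ (λ c₃ f c₀ c₁ c₂ → f c₀ c₁ c₂ c₃) (even j)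
        (cong₂ (λ c₄ f c₀ c₁ c₂ c₃ → f c₀ c₁ c₂ c₃ c₄) (shift-double odd j)
        (cong₂ (λ c₅ c₆ c₀ c₁ c₂ c₃ c₄ → poly c₀ c₁ c₂ c₃ c₄ c₅ c₆) (shift²-double even j)
          (shift-double (shift²-1+double {d = K us} odd) j)))))) ⟩
  poly 0ℚ (K us (suc j)) 0ℚ (K us j) 0ℚ (shift (K us) j) 0ℚ ≡⟨ lemma r s t (K us (suc j)) (K us j) (shift (K us) j) ⟩
  (r + s + t) * quad 1ℚ 2ℚ 1ℚ (K us) (suc j) + r * s * t * K us j ∎
  where
  open ≡-Reasoning
  1+ 2+ 3+ : ℕ → ℕ
  1+ = suc
  2+ = suc ∘ suc
  3+ = suc ∘ suc ∘ suc
  k = double j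
  c = e (evens us)
  r = trace x
  s = trace y
  t = trace z
  odd  = e-evens-1+double us
  even = e-evens-double us
  poly : ℚ → ℚ → ℚ → ℚ → ℚ → ℚ → ℚ → ℚ
  poly c₀ c₁ c₂ c₃ c₄ c₅ c₆ = 1ℚ * f c₀ c₁ c₂ c₃ c₄ + r * f c₁ c₂ c₃ c₄ c₅ + 1ℚ * f c₂ c₃ c₄ c₅ c₆
    where
    f : ℚ → ℚ → ℚ → ℚ → ℚ → ℚ
    f c₀ c₁ c₂ c₃ c₄ = 1ℚ * 1ℚ * c₀ + (1ℚ * t + s * 1ℚ) * c₁ + (1ℚ * 1ℚ + s * t + 1ℚ * 1ℚ) * c₂
      + (s * 1ℚ + 1ℚ * t) * c₃ + 1ℚ * 1ℚ * c₄
  lemma : ∀ r s t k₁ k₃ k₅ → let f = λ c₀ c₁ c₂ c₃ c₄ → 1ℚ * 1ℚ * c₀ + (1ℚ * t + s * 1ℚ) * c₁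
                                      + (1ℚ * 1ℚ + s * t + 1ℚ * 1ℚ) * c₂ + (s * 1ℚ + 1ℚ * t) * c₃ + 1ℚ * 1ℚ * c₄ in
    1ℚ * f 0ℚ k₁ 0ℚ k₃ 0ℚ + r * f k₁ 0ℚ k₃ 0ℚ k₅ + 1ℚ * f 0ℚ k₃ 0ℚ k₅ 0ℚ ≡
    (r + s + t) * (1ℚ * k₁ + 2ℚ * k₃ + 1ℚ * k₅) + r * s * t * k₃
  lemma = solve-∀ ℚ-ring

⅛ : ℚ
⅛ = ½ * ½ * ½

-- The tangent section at (2, 2, v + v⁻¹) is then the circle of radius² (B² + A²)⁻¹, which has a
-- rational point; B² > 1 keeps its points away from m = ±1, where u = (m + 1)/(m - 1) degenerates.
Good : ℚ → Unit → Set
Good ρ v = ∃[ A ] ∃[ B ] (1ℚ < B * B × trace v ≡ ρ * (B * B + A * A - ½))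

-- With B = x + h and D = x - h, where x h = 1/8, we have B² - D² = 1/2, so v = (ρ D²)⁻¹ and
-- A = (ρ D)⁻¹ satisfy v = ρ A² and v⁻¹ = ρ (B² - 1/2).
infinite-good : ∀ {ρ} → ρ ≢ 0ℚ → Infinite Unitˢ (Good ρ)
infinite-good {ρ} ρ≢0 = infinite-image {S = Unitˢ} {P = λ u → 1ℚ < val u} {S′ = Unitˢ}
  (λ u v → val u ≟ val v) {Good ρ} v fibre (λ {x} {y} → fib {x} {y}) (λ {x} → good {x}) infinite-units>1
  where
  open ≡-Reasoning
  ρᵘ : Unit
  ρᵘ = mkUnit ρ ρ≢0
  h B D : Unit → ℚ
  h x = ⅛ * inv x
  B x = val x + h x
  D x = val x - h x

  1<x² : ∀ {x} → 1ℚ < x → 1ℚ < x * x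
  1<x² {x} 1<x = <-trans 1<x (subst (_< x * x) (*-identityʳ x)
    (*-monoʳ-<-pos x {{positive (<-trans (positive⁻¹ 1ℚ) 1<x)}} 1<x))

  xh≡⅛ : ∀ x → val x * h x ≡ ⅛
  xh≡⅛ x = trans (lemma (val x) (inv x)) (cong (⅛ *_) (val*inv≡1 x))
    where
    lemma : ∀ x y → x * (⅛ * y) ≡ ⅛ * (x * y)
    lemma = solve-∀ ℚ-ring

  B²≡½+D² : ∀ x → B x * B x ≡ ½ + D x * D x
  B²≡½+D² x = trans (lemma (val x) (h x)) (cong (λ t → 4ℚ * t + D x * D x) (xh≡⅛ x))
    where
    lemma : ∀ x h → (x + h) * (x + h) ≡ 4ℚ * (x * h) + (x - h) * (x - h)
    lemma = solve-∀ ℚ-ring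

  1<B² : ∀ {x} → 1ℚ < val x → 1ℚ < B x * B x
  1<B² {x} 1<x = subst (1ℚ <_)
    (trans (lemma (val x) (h x))
      (trans (cong (λ t → B x * B x + 2ℚ * (⅛ - t)) (xh≡⅛ x)) (+-identityʳ _)))
    (x<y+z² (h x) (x<y+z² ½ (1<x² 1<x)))
    where
    lemma : ∀ x h → x * x + ½ * ½ + h * h ≡ (x + h) * (x + h) + 2ℚ * (½ * ½ * ½ - x * h)
    lemma = solve-∀ ℚ-ring

  -- If D = 0 then x = h, so x² = xh = 1/8, against x > 1.
  D≢0 : ∀ {x} → 1ℚ < val x → D x ≢ 0ℚ
  D≢0 {x} 1<x D≡0 = <-asym ⅛<1 (subst (1ℚ <_) x²≡⅛ (1<x² 1<x))
    where
    ⅛<1 : ⅛ < 1ℚ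
    ⅛<1 = toWitness {a? = ⅛ <? 1ℚ} tt
    x²≡⅛ : val x * val x ≡ ⅛
    x²≡⅛ = trans (cong (val x *_) (a-b≡0⇒a≡b {val x} {h x} D≡0)) (xh≡⅛ x)

  v : ∀ x → 1ℚ < val x → Unit
  v x 1<x = flip (unit (ρ * (D x * D x)) (inv ρᵘ * (inv d * inv d))
    (trans (lemma ρ (D x) (inv ρᵘ) (inv d)) (cong₂ (λ s t → s * (t * t)) (val*inv≡1 ρᵘ) (val*inv≡1 d))))
    where
    d = mkUnit (D x) (D≢0 {x} 1<x)
    lemma : ∀ a b c d → a * (b * b) * (c * (d * d)) ≡ a * c * (b * d * (b * d))
    lemma = solve-∀ ℚ-ring

  hᵘ : Unit → Unit
  hᵘ x = unit (h x) (8ℚ * val x) (trans (lemma (val x) (inv x)) (val*inv≡1 x))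
    where
    lemma : ∀ x y → ⅛ * y * (8ℚ * x) ≡ x * y
    lemma = solve-∀ ℚ-ring

  fibre : Unit → List Unit
  fibre x = x ∷ hᵘ x ∷ opposite x ∷ opposite (hᵘ x) ∷ []

  -- The value of `v` determines D², hence also B² = 1/2 + D². Thus B and D are known up to sign,
  -- and x = (B + D)/2 leaves the candidates x, h, -h, -x.
  fib : ∀ {x y} (1<x : 1ℚ < val x) (1<y : 1ℚ < val y) → val (v x 1<x) ≡ val (v y 1<y) → y ∈ᵘ fibre x
  fib {x} {y} 1<x 1<y eq =
    [ (λ B≡ → [ (λ D≡ → here (half B≡ D≡ (lemma₁ (val x) (h x))))
               , (λ D≡ → there (here (half B≡ D≡ (lemma₂ (val x) (h x))))) ]′ D-cases)
    , (λ B≡- → [ (λ D≡ → there (there (there (here (half B≡- D≡ (lemma₃ (val x) (h x)))))))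
               , (λ D≡ → there (there (here (half B≡- D≡ (lemma₄ (val x) (h x)))))) ]′ D-cases)
    ]′ (square-fibre (B x) (B y) (trans (B²≡½+D² y) (trans (cong (½ +_) D²≡D²) (sym (B²≡½+D² x)))))
    where
    inv-v : inv (v x 1<x) ≡ inv (v y 1<y)
    inv-v = inverse-unique (v y 1<y) (trans (cong (inv (v x 1<x) *_) (sym eq)) (val*inv≡1 (flip (v x 1<x))))
    D²≡D² : D y * D y ≡ D x * D x
    D²≡D² = IntegralDomain.*-cancelʳ-≉0 ℚ-integralDomain ρ≢0
      (trans (*-comm _ ρ) (trans (sym inv-v) (*-comm ρ _)))
    D-cases : D y ≡ D x ⊎ D y ≡ - D x
    D-cases = square-fibre (D x) (D y) D²≡D²
    half : ∀ {b d z} → B y ≡ b → D y ≡ d → ½ * (b + d) ≡ z → val y ≡ z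
    half refl refl e = trans (lemma (val y) (h y)) e
      where
      lemma : ∀ x h → x ≡ ½ * (x + h + (x - h))
      lemma = solve-∀ ℚ-ring
    lemma₁ : ∀ x h → ½ * (x + h + (x - h)) ≡ x
    lemma₁ = solve-∀ ℚ-ring
    lemma₂ : ∀ x h → ½ * (x + h + - (x - h)) ≡ h
    lemma₂ = solve-∀ ℚ-ring
    lemma₃ : ∀ x h → ½ * (- (x + h) + (x - h)) ≡ - h
    lemma₃ = solve-∀ ℚ-ring
    lemma₄ : ∀ x h → ½ * (- (x + h) + - (x - h)) ≡ - x
    lemma₄ = solve-∀ ℚ-ring

  good : ∀ {x} (1<x : 1ℚ < val x) → Good ρ (v x 1<x)
  good {x} 1<x = inv ρᵘ * inv d , B x , 1<B² {x} 1<x , sym (begin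
    ρ * (B x * B x + A * A - ½)                   ≡⟨ cong (λ t → ρ * (t + A * A - ½)) (B²≡½+D² x) ⟩
    ρ * (½ + D x * D x + A * A - ½)               ≡⟨ lemma ρ (inv ρᵘ) (D x) (inv d) ⟩
    ρ * inv ρᵘ * (inv ρᵘ * (inv d * inv d)) + ρ * (D x * D x)
      ≡⟨ cong (_+ ρ * (D x * D x)) (trans (cong (_* (inv ρᵘ * (inv d * inv d))) (val*inv≡1 ρᵘ))
                                        (*-identityˡ (inv ρᵘ * (inv d * inv d)))) ⟩
    trace (v x 1<x) ∎)
    where
    d = mkUnit (D x) (D≢0 {x} 1<x)
    A = inv ρᵘ * inv d
    lemma : ∀ ρ i D d → ρ * (½ + D * D + i * d * (i * d) - ½) ≡ ρ * i * (i * (d * d)) + ρ * (D * D)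
    lemma = solve-∀ ℚ-ring

nonzero-many-odd-odd : ∀ j m → j ℕ.≤ m → NonzeroManySolutions (suc (double (suc j))) (suc (double (suc m)))
nonzero-many-odd-odd j m j≤m =
  let us , len , nz =
        -- The three triples yield α, β and α + 4β. The first two make ρ = α/β defined and nonzero;
        -- the third is the slope of the value `a` as a function of `trace v`.
        K-nonvanishing ((1ℚ , 2ℚ , 1ℚ) ∷ (0ℚ , 1ℚ , 0ℚ) ∷ (1ℚ , 2ℚ + 4ℚ , 1ℚ) ∷ [])
          ((λ ()) ∷ (λ ()) ∷ (λ ()) ∷ []) j≤m
  in from us len (All.head nz) (All.head (All.tail nz) ∘ trans (lemma₀ (K us (suc j)) (K us j) (shift (K us) j)))
       (All.head (All.tail (All.tail nz)) ∘ trans (lemma₁ (K us (suc j)) (K us j) (shift (K us) j)))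
  where
  lemma₀ : ∀ c₀ c₁ c₂ → 0ℚ * c₀ + 1ℚ * c₁ + 0ℚ * c₂ ≡ c₁
  lemma₀ = solve-∀ ℚ-ring
  lemma₁ : ∀ c₀ c₁ c₂ → 1ℚ * c₀ + (2ℚ + 4ℚ) * c₁ + 1ℚ * c₂ ≡ 1ℚ * c₀ + 2ℚ * c₁ + 1ℚ * c₂ + 4ℚ * c₁
  lemma₁ = solve-∀ ℚ-ring
  i n : ℕ
  i = suc (double (suc j))
  n = suc (double (suc m))
  from : ∀ us → length us ≡ m → quad 1ℚ 2ℚ 1ℚ (K us) (suc j) ≢ 0ℚ → K us j ≢ 0ℚ →
    quad 1ℚ 2ℚ 1ℚ (K us) (suc j) + 4ℚ * K us j ≢ 0ℚ → NonzeroManySolutions i n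
  from us len α≢0 β≢0 α+4β≢0 = nonzero-many i n
    (λ { (_ , (v , (A , B , 1<B² , tr) , refl) , refl) → many A B 1<B² v tr })
    (infinite-affine (4ℚ * α) α+4β≢0 (infinite-trace (infinite-good {ρ} (*-≢0 α≢0 (val≢0 (flip βᵘ))))))
    where
    open ≡-Reasoning
    α β ρ : ℚ
    α = quad 1ℚ 2ℚ 1ℚ (K us) (suc j)
    β = K us j
    βᵘ : Unit
    βᵘ = mkUnit β β≢0
    ρ = α * inv βᵘ
    α≡βρ : α ≡ β * ρ
    α≡βρ = sym (trans (lemma α β (inv βᵘ)) (trans (cong (α *_) (val*inv≡1 βᵘ)) (*-identityʳ α)))
      where
      lemma : ∀ a b c → b * (a * c) ≡ a * (b * c)
      lemma = solve-∀ ℚ-ring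
    many : ∀ A B (1<B² : 1ℚ < B * B) v → trace v ≡ ρ * (B * B + A * A - ½) →
      ManySolutions i n (4ℚ * α + (α + 4ℚ * β) * trace v)
    many A B 1<B² v tr = many-units i n (λ t → reciprocal (us′ (val t)))
      -- The first and third entries are the two Cayley values, which together determine the
      -- parameter of the circle.
      (λ {s} {t} eq → sym (C.cayleys-injective (val s) (val t)
        (∷-injectiveˡ eq) (∷-injectiveˡ (∷-injectiveʳ (∷-injectiveʳ eq)))))
      λ t → reciprocal-solution (us′ (val t))
        (cong (suc ∘ suc ∘ suc) (trans (length-withNegatives us) (cong double len)))
        i≤2n
        (trans (e-triple (C.M₁.cayley (val t)) (C.M₂.cayley (val t)) v us j) (value (val t)))
      where
      module C = Circle A B 1<B²
      us′ : ℚ → List Unit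
      us′ t = C.M₁.cayley t ∷ C.M₂.cayley t ∷ v ∷ withNegatives us
      i≤2n : i ℕ.≤ double n
      i≤2n = s≤s (s≤s (s≤s (ℕ.≤-trans (double-mono j≤m) (ℕ.≤-trans (n≤double (double m)) (ℕ.m≤n+m _ 3)))))
      value : ∀ t → let x = trace (C.M₁.cayley t) ; y = trace (C.M₂.cayley t) ; z = trace v in
        (x + y + z) * α + x * y * z * β ≡ 4ℚ * α + (α + 4ℚ * β) * z
      value t = begin
        (x + y + z) * α + x * y * z * β
          ≡⟨ cong₂ (λ x y → (x + y + z) * α + x * y * z * β) (C.M₁.trace-cayley t) (C.M₂.trace-cayley t) ⟩
        (x′ + y′ + z) * α + x′ * y′ * z * β            ≡⟨ cong (λ a → (x′ + y′ + z) * a + x′ * y′ * z * β) α≡βρ ⟩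
        (x′ + y′ + z) * (β * ρ) + x′ * y′ * z * β      ≡⟨ lemma β ρ x′ y′ z ⟩
        β * (ρ * (x′ + y′ + z) + x′ * y′ * z)
          ≡⟨ cong (β *_) (tangent-section ρ C.Q (C.m₁ t * C.m₁ t) (C.m₂ t * C.m₂ t) (C.M₁.μ t) (C.M₂.μ t) z
               (C.M₁.μ[m²-1]≡1 t) (C.M₂.μ[m²-1]≡1 t) (C.on-circle t) tr) ⟩
        β * (4ℚ * ρ + (4ℚ + ρ) * z)                    ≡⟨ lemma′ β ρ z ⟩
        4ℚ * (β * ρ) + (β * ρ + 4ℚ * β) * z            ≡⟨ cong (λ a → 4ℚ * a + (a + 4ℚ * β) * z) α≡βρ ⟨
        4ℚ * α + (α + 4ℚ * β) * z ∎
        where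
        x = trace (C.M₁.cayley t)
        y = trace (C.M₂.cayley t)
        z = trace v
        x′ = 2ℚ + 4ℚ * C.M₁.μ t
        y′ = 2ℚ + 4ℚ * C.M₂.μ t
        lemma : ∀ β ρ x y z → (x + y + z) * (β * ρ) + x * y * z * β ≡ β * (ρ * (x + y + z) + x * y * z)
        lemma = solve-∀ ℚ-ring
        lemma′ : ∀ β ρ z → β * (4ℚ * ρ + (4ℚ + ρ) * z) ≡ 4ℚ * (β * ρ) + (β * ρ + 4ℚ * β) * z
        lemma′ = solve-∀ ℚ-ring

-- 2-adic parity and the elliptic curve

fromℤ-+ : ∀ a b → fromℤ (a ℤ.+ b) ≡ fromℤ a + fromℤ b
fromℤ-+ a b = toℚᵘ-injective (ℚᵘ.≃-trans
  (ℚᵘ.*≡* (cong (ℤ._* ℤ.1ℤ) (sym (cong₂ ℤ._+_ (ℤ.*-identityʳ a) (ℤ.*-identityʳ b)))))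
  (ℚᵘ.≃-sym (toℚᵘ-homo-+ (fromℤ a) (fromℤ b))))

fromℤ-* : ∀ a b → fromℤ (a ℤ.* b) ≡ fromℤ a * fromℤ b
fromℤ-* a b = toℚᵘ-injective (ℚᵘ.≃-sym (toℚᵘ-homo-* (fromℤ a) (fromℤ b)))

fromℤ-injective : ∀ {a b} → fromℤ a ≡ fromℤ b → a ≡ b
fromℤ-injective = cong ↥_

record Integral (x : ℚ) : Set where
  constructor integral
  field
    integer   : ℤ
    ≡-integer : x ≡ fromℤ integer

integral-1 : Integral 1ℚ
integral-1 = integral ℤ.1ℤ refl

integral-+ : ∀ {x y} → Integral x → Integral y → Integral (x + y)
integral-+ (integral a refl) (integral b refl) = integral (a ℤ.+ b) (sym (fromℤ-+ a b))

integral-* : ∀ {x y} → Integral x → Integral y → Integral (x * y)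
integral-* (integral a refl) (integral b refl) = integral (a ℤ.* b) (sym (fromℤ-* a b))

integral-neg : ∀ {x} → Integral x → Integral (- x)
integral-neg {x} x-int = subst Integral (lemma x) (integral-* (integral ℤ.-1ℤ refl) x-int)
  where
  lemma : ∀ x → - 1ℚ * x ≡ - x
  lemma = solve-∀ ℚ-ring

integral-2 : Integral 2ℚ
integral-2 = integral-+ integral-1 integral-1

2x≢1 : ∀ {x} → Integral x → 2ℚ * x ≢ 1ℚ
2x≢1 (integral a refl) eq = 2n≢1 ℤ.∣ a ∣ (trans (sym (ℤ.abs-* (ℤ.+ 2) a))
  (cong ℤ.∣_∣ (fromℤ-injective {ℤ.+ 2 ℤ.* a} {ℤ.1ℤ} (trans (fromℤ-* (ℤ.+ 2) a) eq))))
  where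
  2n≢1 : ∀ n → 2 ℕ.* n ≢ 1
  2n≢1 (suc n) eq with trans (sym (ℕ.+-suc n (n ℕ.+ 0))) (ℕ.suc-injective eq)
  ... | ()

-- The localisation of ℤ at 2. The odd denominator 1 + 2d need not be the reduced one, so no
-- coprimality has to be tracked.
record 2-Integral (x : ℚ) : Set where
  constructor over
  field
    d                : ℚ
    d-integral       : Integral d
    x[1+2d]-integral : Integral (x * (1ℚ + 2ℚ * d))

2-integral : ∀ {x} → Integral x → 2-Integral x
2-integral {x} x-int = over 0ℚ (integral ℤ.0ℤ refl) (subst Integral (sym (*-identityʳ x)) x-int)

private
  -- From (1 + 2d)(1 + 2e) = 1 + 2(d + e + 2de), a common odd denominator.
  common : ∀ {d e} → Integral d → Integral e → Integral (d + e + 2ℚ * d * e)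
  common d-int e-int = integral-+ (integral-+ d-int e-int) (integral-* (integral-* integral-2 d-int) e-int)

  1+2_-integral : ∀ {d} → Integral d → Integral (1ℚ + 2ℚ * d)
  1+2 d-int -integral = integral-+ integral-1 (integral-* integral-2 d-int)

2-integral-+ : ∀ {x y} → 2-Integral x → 2-Integral y → 2-Integral (x + y)
2-integral-+ {x} {y} (over d d-int xd-int) (over e e-int ye-int) = over _ (common d-int e-int)
  (subst Integral (lemma x y d e)
    (integral-+ (integral-* xd-int (1+2 e-int -integral)) (integral-* ye-int (1+2 d-int -integral))))
  where
  lemma : ∀ x y d e → x * (1ℚ + 2ℚ * d) * (1ℚ + 2ℚ * e) + y * (1ℚ + 2ℚ * e) * (1ℚ + 2ℚ * d) ≡
    (x + y) * (1ℚ + 2ℚ * (d + e + 2ℚ * d * e))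
  lemma = solve-∀ ℚ-ring

2-integral-* : ∀ {x y} → 2-Integral x → 2-Integral y → 2-Integral (x * y)
2-integral-* {x} {y} (over d d-int xd-int) (over e e-int ye-int) = over _ (common d-int e-int)
  (subst Integral (lemma x y d e) (integral-* xd-int ye-int))
  where
  lemma : ∀ x y d e → x * (1ℚ + 2ℚ * d) * (y * (1ℚ + 2ℚ * e)) ≡ x * y * (1ℚ + 2ℚ * (d + e + 2ℚ * d * e))
  lemma = solve-∀ ℚ-ring

2-integral-neg : ∀ {x} → 2-Integral x → 2-Integral (- x)
2-integral-neg {x} (over d d-int xd-int) = over d d-int
  (subst Integral (neg-distribˡ-* x (1ℚ + 2ℚ * d)) (integral-neg xd-int))

-- Otherwise x(1 + 2d) - d would be an ordinary integer equal to 1/2.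
½-not-2-integral : ∀ {x} → 2-Integral x → 2ℚ * x ≢ 1ℚ
½-not-2-integral {x} (over d d-int xd-int) 2x≡1 = 2x≢1 (integral-+ xd-int (integral-neg d-int))
  (trans (lemma x d) (trans (cong (λ t → t * (1ℚ + 2ℚ * d) - 2ℚ * d) 2x≡1) (lemma′ d)))
  where
  lemma : ∀ x d → 2ℚ * (x * (1ℚ + 2ℚ * d) + - d) ≡ 2ℚ * x * (1ℚ + 2ℚ * d) - 2ℚ * d
  lemma = solve-∀ ℚ-ring
  lemma′ : ∀ d → 1ℚ * (1ℚ + 2ℚ * d) - 2ℚ * d ≡ 1ℚ
  lemma′ = solve-∀ ℚ-ring

-- The units of the local ring: its residue field has two elements, so they are the elements
-- congruent to 1 modulo 2.
record Odd (x : ℚ) : Set where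
  constructor odd
  field
    half            : ℚ
    half-2-integral : 2-Integral half
    ≡1+2half        : x ≡ 1ℚ + 2ℚ * half

odd-* : ∀ {x y} → Odd x → Odd y → Odd (x * y)
odd-* (odd h h∈ refl) (odd k k∈ refl) = odd (h + k + 2ℚ * (h * k))
  (2-integral-+ (2-integral-+ h∈ k∈) (2-integral-* (2-integral integral-2) (2-integral-* h∈ k∈))) (lemma h k)
  where
  lemma : ∀ h k → (1ℚ + 2ℚ * h) * (1ℚ + 2ℚ * k) ≡ 1ℚ + 2ℚ * (h + k + 2ℚ * (h * k))
  lemma = solve-∀ ℚ-ring

odd-+even : ∀ {x y} → Odd x → 2-Integral y → Odd (x + 2ℚ * y)
odd-+even {y = y} (odd h h∈ refl) y∈ = odd (h + y) (2-integral-+ h∈ y∈) (lemma h y)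
  where
  lemma : ∀ h y → 1ℚ + 2ℚ * h + 2ℚ * y ≡ 1ℚ + 2ℚ * (h + y)
  lemma = solve-∀ ℚ-ring

odd-neg : ∀ {x} → Odd x → Odd (- x)
odd-neg (odd h h∈ refl) = odd (- (1ℚ + h)) (2-integral-neg (2-integral-+ (2-integral integral-1) h∈)) (lemma h)
  where
  lemma : ∀ h → - (1ℚ + 2ℚ * h) ≡ 1ℚ + 2ℚ * - (1ℚ + h)
  lemma = solve-∀ ℚ-ring

even-not-odd : ∀ {x} → 2-Integral x → ¬ Odd (2ℚ * x)
even-not-odd {x} x∈ (odd h h∈ 2x≡1+2h) = ½-not-2-integral (2-integral-+ x∈ (2-integral-neg h∈))
  (trans (lemma x h) (trans (cong (_- 2ℚ * h) 2x≡1+2h) (lemma′ h)))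
  where
  lemma : ∀ x h → 2ℚ * (x + - h) ≡ 2ℚ * x - 2ℚ * h
  lemma = solve-∀ ℚ-ring
  lemma′ : ∀ h → 1ℚ + 2ℚ * h - 2ℚ * h ≡ 1ℚ
  lemma′ = solve-∀ ℚ-ring

odd⇒≢0 : ∀ {x} → Odd x → x ≢ 0ℚ
odd⇒≢0 x-odd refl = even-not-odd (2-integral (integral ℤ.0ℤ refl)) x-odd

odd⇒2-integral : ∀ {x} → Odd x → 2-Integral x
odd⇒2-integral (odd h h∈ refl) = 2-integral-+ (2-integral integral-1) (2-integral-* (2-integral integral-2) h∈)

-- For y = 1/(1 + 2h), half of y - 1 is -h/(1 + 2h), and the odd integer (1 + 2h)(1 + 2d) clears its
-- denominator.
odd-inv : ∀ u → Odd (val u) → Odd (inv u)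
odd-inv (unit .(1ℚ + 2ℚ * h) y xy≡1) (odd h (over d d-int hd-int) refl) = odd (½ * (y - 1ℚ))
  (over (d + h * (1ℚ + 2ℚ * d)) (integral-+ d-int hd-int) (subst Integral (sym (begin
    ½ * (y - 1ℚ) * (1ℚ + 2ℚ * (d + h * (1ℚ + 2ℚ * d)))  ≡⟨ lemma y h d ⟩
    ½ * ((1ℚ + 2ℚ * h) * y - (1ℚ + 2ℚ * h)) * (1ℚ + 2ℚ * d)
      ≡⟨ cong (λ t → ½ * (t - (1ℚ + 2ℚ * h)) * (1ℚ + 2ℚ * d)) xy≡1 ⟩
    ½ * (1ℚ - (1ℚ + 2ℚ * h)) * (1ℚ + 2ℚ * d)  ≡⟨ lemma′ h d ⟩
    - (h * (1ℚ + 2ℚ * d)) ∎)) (integral-neg hd-int))) (lemma″ y)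
  where
  open ≡-Reasoning
  lemma : ∀ y h d → ½ * (y - 1ℚ) * (1ℚ + 2ℚ * (d + h * (1ℚ + 2ℚ * d))) ≡
    ½ * ((1ℚ + 2ℚ * h) * y - (1ℚ + 2ℚ * h)) * (1ℚ + 2ℚ * d)
  lemma = solve-∀ ℚ-ring
  lemma′ : ∀ h d → ½ * (1ℚ - (1ℚ + 2ℚ * h)) * (1ℚ + 2ℚ * d) ≡ - (h * (1ℚ + 2ℚ * d))
  lemma′ = solve-∀ ℚ-ring
  lemma″ : ∀ y → y ≡ 1ℚ + 2ℚ * (½ * (y - 1ℚ))
  lemma″ = solve-∀ ℚ-ring

odd-quotient : ∀ {w} x → Odd x → Odd (w * x) → Odd w
odd-quotient {w} x x-odd wx-odd = subst Odd
  (trans (*-assoc w x (inv xᵘ)) (trans (cong (w *_) (val*inv≡1 xᵘ)) (*-identityʳ w)))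
  (odd-* wx-odd (odd-inv xᵘ x-odd))
  where
  xᵘ : Unit
  xᵘ = mkUnit x (odd⇒≢0 x-odd)

-- Odd squares are 1 modulo 4, so x² + 1 is 2 modulo 4.
half[1+odd²]-odd : ∀ {x} → Odd x → Odd (½ * (x * x + 1ℚ))
half[1+odd²]-odd (odd h h∈ refl) = odd (h + h * h) (2-integral-+ h∈ (2-integral-* h∈ h∈)) (lemma h)
  where
  lemma : ∀ h → ½ * ((1ℚ + 2ℚ * h) * (1ℚ + 2ℚ * h) + 1ℚ) ≡ 1ℚ + 2ℚ * (h + h * h)
  lemma = solve-∀ ℚ-ring

2^_ : ℕ → ℚ
2^ zero  = 1ℚ
2^ suc k = 2ℚ * 2^ k

2^-2-integral : ∀ k → 2-Integral (2^ k)
2^-2-integral zero    = 2-integral integral-1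
2^-2-integral (suc k) = 2-integral-* (2-integral integral-2) (2^-2-integral k)

2^-+ : ∀ k l → 2^ (k ℕ.+ l) ≡ 2^ k * 2^ l
2^-+ zero    l = sym (*-identityˡ (2^ l))
2^-+ (suc k) l = trans (cong (2ℚ *_) (2^-+ k l)) (sym (*-assoc 2ℚ (2^ k) (2^ l)))

-- `Odd (x * 2^ k)` says that `x` has 2-adic valuation -k. Multiplying an odd number by a further
-- positive power of 2 makes it even.
valuation-< : ∀ x {k l} → k ℕ.< l → Odd (x * 2^ k) → ¬ Odd (x * 2^ l)
valuation-< x {k} (s≤s {n = l} k≤l) odd-k odd-l = even-not-odd
  (2-integral-* (odd⇒2-integral odd-k) (2^-2-integral (l ℕ.∸ k)))
  (subst Odd (trans (cong (λ p → x * (2ℚ * p)) (trans (cong 2^_ (sym (ℕ.m+[n∸m]≡n k≤l))) (2^-+ k (l ℕ.∸ k))))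
    (lemma x (2^ k) (2^ (l ℕ.∸ k)))) odd-l)
  where
  lemma : ∀ x a b → x * (2ℚ * (a * b)) ≡ 2ℚ * (x * a * b)
  lemma = solve-∀ ℚ-ring

valuation-unique : ∀ x k l → Odd (x * 2^ k) → Odd (x * 2^ l) → k ≡ l
valuation-unique x k l odd-k odd-l with ℕ.<-cmp k l
... | tri< k<l _ _ = ⊥-elim (valuation-< x k<l odd-k odd-l)
... | tri≈ _ k≡l _ = k≡l
... | tri> _ _ l<k = ⊥-elim (valuation-< x l<k odd-l odd-k)

-- Points of y + y⁻¹ + z + z⁻¹ = t close 2-adically to the point at infinity that is the origin.
record Point (t : ℚ) (k : ℕ) : Set where
  constructor point
  field
    y z : Unit
    on-curve : trace y + trace z ≡ t
    η-odd : Odd (val y * 2^ suc k)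
    ζ-odd : Odd (val z * 2^ suc k)
    -- η and ζ differ by 2 modulo 4, so y - z has valuation exactly -k. This fixes the valuation of
    -- (yz - 1)/(y - z) under doubling.
    θ-odd : Odd (½ * (val y * 2^ suc k - val z * 2^ suc k))

-- The double of (y, z) is (n m, - n m⁻¹) with n = (yz - 1)/(y - z), m = z (y² - 1)/(y (z² - 1));
-- it stays on the curve because y + y⁻¹ + z + z⁻¹ = (n - n⁻¹)(m - m⁻¹).
module Doubling {t : ℚ} {k : ℕ} (pt : Point t k) where
  open Point pt
  open ≡-Reasoning

  private
    p η ζ θ : ℚ
    p = 2^ suc k
    η = val y * p
    ζ = val z * p
    θ = ½ * (η - ζ)

    odd-p² : ∀ {x} → Odd x → Odd (x - p * p)
    odd-p² {x} x-odd = subst Odd (lemma x (2^ k)) (odd-+even x-odd (2-integral-neg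
      (2-integral-* (2-integral integral-2) (2-integral-* (2^-2-integral k) (2^-2-integral k)))))
      where
      lemma : ∀ x q → x + 2ℚ * - (2ℚ * (q * q)) ≡ x - 2ℚ * q * (2ℚ * q)
      lemma = solve-∀ ℚ-ring

    cancel-≢0 : ∀ {x y} c → c * x ≡ y → y ≢ 0ℚ → x ≢ 0ℚ
    cancel-≢0 c eq y≢0 refl = y≢0 (trans (sym eq) (*-zeroʳ c))

    square-minus-1 : ∀ x → p * p * (x * x - 1ℚ) ≡ x * p * (x * p) - p * p
    square-minus-1 x = lemma x p
      where
      lemma : ∀ x p → p * p * (x * x - 1ℚ) ≡ x * p * (x * p) - p * p
      lemma = solve-∀ ℚ-ring

    product-minus-1 : p * p * (val y * val z - 1ℚ) ≡ η * ζ - p * p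
    product-minus-1 = lemma (val y) (val z) p
      where
      lemma : ∀ y z p → p * p * (y * z - 1ℚ) ≡ y * p * (z * p) - p * p
      lemma = solve-∀ ℚ-ring

    Y-odd : Odd (η * η - p * p)
    Y-odd = odd-p² (odd-* η-odd η-odd)
    Z-odd : Odd (ζ * ζ - p * p)
    Z-odd = odd-p² (odd-* ζ-odd ζ-odd)
    A-odd : Odd (η * ζ - p * p)
    A-odd = odd-p² (odd-* η-odd ζ-odd)

    Y Z A b : Unit
    Y = mkUnit (val y * val y - 1ℚ) (cancel-≢0 (p * p) (square-minus-1 (val y)) (odd⇒≢0 Y-odd))
    Z = mkUnit (val z * val z - 1ℚ) (cancel-≢0 (p * p) (square-minus-1 (val z)) (odd⇒≢0 Z-odd))
    A = mkUnit (val y * val z - 1ℚ) (cancel-≢0 (p * p) product-minus-1 (odd⇒≢0 A-odd))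
    b = mkUnit (val y - val z) (cancel-≢0 (½ * p) (lemma (val y) (val z) p) (odd⇒≢0 θ-odd))
      where
      lemma : ∀ y z p → ½ * p * (y - z) ≡ ½ * (y * p - z * p)
      lemma = solve-∀ ℚ-ring

    n m : Unit
    n = A ⊛ flip b
    m = z ⊛ Y ⊛ flip (y ⊛ Z)

    m*yZ≡zY : val m * (val y * val Z) ≡ val z * val Y
    m*yZ≡zY = trans (lemma (val z * val Y) (val (y ⊛ Z)) (inv (y ⊛ Z)))
      (trans (cong (val z * val Y *_) (val*inv≡1 (y ⊛ Z))) (*-identityʳ _))
      where
      lemma : ∀ a b c → a * c * b ≡ a * (b * c)
      lemma = solve-∀ ℚ-ring

    n*b≡A : val n * val b ≡ val A
    n*b≡A = trans (lemma (val A) (val b) (inv b)) (trans (cong (val A *_) (val*inv≡1 b)) (*-identityʳ _))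
      where
      lemma : ∀ a b c → a * c * b ≡ a * (b * c)
      lemma = solve-∀ ℚ-ring

    -- Multiplied by p³, the numerator z(y² - 1) and the denominator y(z² - 1) of m both become odd.
    m-odd : Odd (val m)
    m-odd = odd-quotient (η * (ζ * ζ - p * p)) (odd-* η-odd Z-odd) (subst Odd (begin
      ζ * (η * η - p * p)                         ≡⟨ lemma (val z) (val y) p ⟩
      val z * val Y * (p * p * p)                 ≡⟨ cong (_* (p * p * p)) m*yZ≡zY ⟨
      val m * (val y * val Z) * (p * p * p)       ≡⟨ lemma′ (val m) (val y) (val z) p ⟩
      val m * (η * (ζ * ζ - p * p)) ∎) (odd-* ζ-odd Y-odd))
      where
      lemma : ∀ z y p → z * p * (y * p * (y * p) - p * p) ≡ z * (y * y - 1ℚ) * (p * p * p)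
      lemma = solve-∀ ℚ-ring
      lemma′ : ∀ m y z p → m * (y * (z * z - 1ℚ)) * (p * p * p) ≡ m * (y * p * (z * p * (z * p) - p * p))
      lemma′ = solve-∀ ℚ-ring

    ν : ℚ
    ν = val n * (2ℚ * p)

    -- Multiplied by p², yz - 1 becomes odd, and so does y - z when multiplied by p/2. Hence n has
    -- valuation -(k + 2).
    ν-odd : Odd ν
    ν-odd = odd-quotient θ θ-odd (subst Odd (begin
      η * ζ - p * p              ≡⟨ product-minus-1 ⟨
      p * p * val A              ≡⟨ cong (p * p *_) n*b≡A ⟨
      p * p * (val n * val b)    ≡⟨ lemma (val n) (val y) (val z) p ⟩
      ν * θ ∎) A-odd)
      where
      lemma : ∀ n y z p → p * p * (n * (y - z)) ≡ n * (2ℚ * p) * (½ * (y * p - z * p))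
      lemma = solve-∀ ℚ-ring

    y′ z′ : Unit
    y′ = n ⊛ m
    z′ = opposite (n ⊛ flip m)

    trace-sum : trace y′ + trace z′ ≡ (val n - inv n) * (val m - inv m)
    trace-sum = lemma (val n) (inv n) (val m) (inv m)
      where
      lemma : ∀ n n⁻¹ m m⁻¹ → n * m + n⁻¹ * m⁻¹ + (- (n * m⁻¹) + - (n⁻¹ * m)) ≡ (n - n⁻¹) * (m - m⁻¹)
      lemma = solve-∀ ℚ-ring

    quotient-minus-inverse : ∀ u v →
      (val (u ⊛ flip v) - inv (u ⊛ flip v)) * (val u * val v) ≡ val u * val u - val v * val v
    quotient-minus-inverse (unit x x⁻¹ xx⁻¹≡1) (unit w w⁻¹ ww⁻¹≡1) = begin
      (x * w⁻¹ - x⁻¹ * w) * (x * w)             ≡⟨ lemma x x⁻¹ w w⁻¹ ⟩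
      x * x * (w * w⁻¹) - w * w * (x * x⁻¹)     ≡⟨ cong₂ (λ s t → x * x * s - w * w * t) ww⁻¹≡1 xx⁻¹≡1 ⟩
      x * x * 1ℚ - w * w * 1ℚ                   ≡⟨ cong₂ _-_ (*-identityʳ (x * x)) (*-identityʳ (w * w)) ⟩
      x * x - w * w ∎
      where
      lemma : ∀ x x⁻¹ w w⁻¹ → (x * w⁻¹ - x⁻¹ * w) * (x * w) ≡ x * x * (w * w⁻¹) - w * w * (x * x⁻¹)
      lemma = solve-∀ ℚ-ring

    trace-sum-cleared : (trace y + trace z) * (val y * val z) ≡ (val y + val z) * (val y * val z + 1ℚ)
    trace-sum-cleared = trans (lemma (val y) (inv y) (val z) (inv z))
      (trans (cong₂ (λ s t → (val y + val z) * (val y * val z) + s * val z + t * val y) (val*inv≡1 y) (val*inv≡1 z))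
        (lemma′ (val y) (val z)))
      where
      lemma : ∀ y y⁻¹ z z⁻¹ → (y + y⁻¹ + (z + z⁻¹)) * (y * z) ≡ (y + z) * (y * z) + y * y⁻¹ * z + z * z⁻¹ * y
      lemma = solve-∀ ℚ-ring
      lemma′ : ∀ y z → (y + z) * (y * z) + 1ℚ * z + 1ℚ * y ≡ (y + z) * (y * z + 1ℚ)
      lemma′ = solve-∀ ℚ-ring

    -- Each difference a/b - b/a is (a² - b²)/(ab). Multiplying by the denominators of both
    -- differences leaves a polynomial identity in y and z.
    on-curve′ : trace y′ + trace z′ ≡ t
    on-curve′ = trans (IntegralDomain.*-cancelʳ-≉0 ℚ-integralDomain (val≢0 (A ⊛ b ⊛ (z ⊛ Y ⊛ (y ⊛ Z)))) (begin
      (trace y′ + trace z′) * (val A * val b * (val z * val Y * (val y * val Z)))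
        ≡⟨ cong (_* (val A * val b * (val z * val Y * (val y * val Z)))) trace-sum ⟩
      (val n - inv n) * (val m - inv m) * (val A * val b * (val z * val Y * (val y * val Z)))
        ≡⟨ *-interchange (val n - inv n) (val m - inv m) (val A * val b) (val z * val Y * (val y * val Z)) ⟩
      (val n - inv n) * (val A * val b) * ((val m - inv m) * (val z * val Y * (val y * val Z)))
        ≡⟨ cong₂ _*_ (quotient-minus-inverse A b) (quotient-minus-inverse (z ⊛ Y) (y ⊛ Z)) ⟩
      (val A * val A - val b * val b) * (val z * val Y * (val z * val Y) - val y * val Z * (val y * val Z))
        ≡⟨ lemma (val y) (val z) ⟩
      (val y + val z) * (val y * val z + 1ℚ) * (val A * val b * (val Y * val Z))
        ≡⟨ cong (_* (val A * val b * (val Y * val Z))) trace-sum-cleared ⟨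
      (trace y + trace z) * (val y * val z) * (val A * val b * (val Y * val Z))
        ≡⟨ lemma′ (trace y + trace z) (val y) (val z) (val A) (val b) (val Y) (val Z) ⟩
      (trace y + trace z) * (val A * val b * (val z * val Y * (val y * val Z))) ∎)) on-curve
      where
      *-interchange : ∀ a b c d → a * b * (c * d) ≡ a * c * (b * d)
      *-interchange = solve-∀ ℚ-ring
      lemma : ∀ y z → let A = y * z - 1ℚ ; b = y - z ; Y = y * y - 1ℚ ; Z = z * z - 1ℚ in
        (A * A - b * b) * (z * Y * (z * Y) - y * Z * (y * Z)) ≡ (y + z) * (y * z + 1ℚ) * (A * b * (Y * Z))
      lemma = solve-∀ ℚ-ring
      lemma′ : ∀ t y z A b Y Z → t * (y * z) * (A * b * (Y * Z)) ≡ t * (A * b * (z * Y * (y * Z)))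
      lemma′ = solve-∀ ℚ-ring

  doubled : Point t (suc k)
  doubled = point y′ z′ on-curve′
    (subst Odd (lemma₁ (val n) (val m) p) (odd-* ν-odd m-odd))
    (subst Odd (lemma₂ (val n) (inv m) p) (odd-neg (odd-* ν-odd (odd-inv m m-odd))))
    -- y′ - z′ = n(m + m⁻¹), so the new θ times m equals ν(m² + 1)/2, which is odd.
    (odd-quotient (val m) m-odd (subst Odd (begin
      ν * (½ * (val m * val m + 1ℚ))              ≡⟨ cong (λ s → ν * (½ * (val m * val m + s))) (val*inv≡1 m) ⟨
      ν * (½ * (val m * val m + val m * inv m))   ≡⟨ lemma₃ (val n) (val m) (inv m) p ⟩
      ½ * (val y′ * (2ℚ * p) - val z′ * (2ℚ * p)) * val m ∎) (odd-* ν-odd (half[1+odd²]-odd m-odd))))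
    where
    lemma₁ : ∀ n m p → n * (2ℚ * p) * m ≡ n * m * (2ℚ * p)
    lemma₁ = solve-∀ ℚ-ring
    lemma₂ : ∀ n m p → - (n * (2ℚ * p) * m) ≡ - (n * m) * (2ℚ * p)
    lemma₂ = solve-∀ ℚ-ring
    lemma₃ : ∀ n m m⁻¹ p → n * (2ℚ * p) * (½ * (m * m + m * m⁻¹)) ≡
      ½ * (n * m * (2ℚ * p) - - (n * m⁻¹) * (2ℚ * p)) * m
    lemma₃ = solve-∀ ℚ-ring

iterate : ∀ {t} → Point t 0 → ∀ k → Point t k
iterate pt zero    = pt
iterate pt (suc k) = Doubling.doubled (iterate pt k)

-- Starting points are y = 1/2 + 2h, z = -1/2. Then η = 1 + 4h and ζ = -1, so θ = 1 + 2h is odd, and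
-- t = y + y⁻¹ - 5/2 takes infinitely many values.
infinite-points : Infinite (≡.setoid ℚ) (λ t → Point t 0)
infinite-points = infinite-⊆ {S = ≡.setoid ℚ} start
  (infinite-affine (- (2ℚ + ½)) {1ℚ} (λ ()) (infinite-trace {P = λ u → ∃[ h ] (val u ≡ y₀ h)}
    (infinite-image {S = ≡.setoid ℕ} {S′ = Unitˢ} (λ u v → val u ≟ val v)
      (λ h _ → mkUnit (y₀ h) (y₀≢0 h)) (_∷ [])
      (λ {g} {h} _ _ eq → here (y₀-injective h g (sym eq))) (λ {h} _ → h , refl) (infinite-ℕ 0))))
  where
  open ≡-Reasoning
  four : ℕ → ℚ
  four h = 2ℚ * (2ℚ * fromℤ (ℤ.+ h))
  y₀ : ℕ → ℚ
  y₀ h = ½ * (1ℚ + four h)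
  double-y₀ : ∀ h → y₀ h * 2^ 1 ≡ 1ℚ + four h
  double-y₀ h = lemma (four h)
    where
    lemma : ∀ a → ½ * (1ℚ + a) * (2ℚ * 1ℚ) ≡ 1ℚ + a
    lemma = solve-∀ ℚ-ring
  integral-ℕ : ∀ h → 2-Integral (fromℤ (ℤ.+ h))
  integral-ℕ h = 2-integral (integral (ℤ.+ h) refl)
  odd-1 : Odd 1ℚ
  odd-1 = odd 0ℚ (2-integral (integral ℤ.0ℤ refl)) refl
  η-odd₀ : ∀ h → Odd (y₀ h * 2^ 1)
  η-odd₀ h = subst Odd (sym (double-y₀ h)) (odd-+even odd-1 (2-integral-* (2-integral integral-2) (integral-ℕ h)))
  y₀≢0 : ∀ h → y₀ h ≢ 0ℚ
  y₀≢0 h eq = odd⇒≢0 (η-odd₀ h) (trans (cong (_* 2^ 1) eq) (*-zeroˡ (2^ 1)))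
  y₀-injective : ∀ g h → y₀ g ≡ y₀ h → g ≡ h
  y₀-injective g h eq = ℤ.+-injective (fromℤ-injective (begin
    fromℤ (ℤ.+ g)          ≡⟨ lemma (fromℤ (ℤ.+ g)) ⟩
    ½ * (y₀ g - ½)         ≡⟨ cong (λ y → ½ * (y - ½)) eq ⟩
    ½ * (y₀ h - ½)         ≡⟨ lemma (fromℤ (ℤ.+ h)) ⟨
    fromℤ (ℤ.+ h) ∎))
    where
    lemma : ∀ x → x ≡ ½ * (½ * (1ℚ + 2ℚ * (2ℚ * x)) - ½)
    lemma = solve-∀ ℚ-ring
  z₀ : Unit
  z₀ = unit (- ½) (- 2ℚ) refl
  start : ∀ {t} → ∃[ s ] ((∃[ u ] ((∃[ h ] (val u ≡ y₀ h)) × trace u ≡ s)) × - (2ℚ + ½) + 1ℚ * s ≡ t) → Point t 0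
  start (_ , (u , (h , u≡y₀) , refl) , refl) = point u z₀ (lemma (val u) (inv u))
    (subst (λ y → Odd (y * 2^ 1)) (sym u≡y₀) (η-odd₀ h)) (odd-neg odd-1)
    (subst Odd (begin
      1ℚ + 2ℚ * fromℤ (ℤ.+ h)                   ≡⟨ lemma′ (fromℤ (ℤ.+ h)) ⟩
      ½ * (1ℚ + four h - - 1ℚ)                  ≡⟨ cong (λ y → ½ * (y - - 1ℚ)) (double-y₀ h) ⟨
      ½ * (y₀ h * 2^ 1 - - 1ℚ)                  ≡⟨ cong (λ y → ½ * (y * 2^ 1 - - 1ℚ)) u≡y₀ ⟨
      ½ * (val u * 2^ 1 - - 1ℚ) ∎) (odd-+even odd-1 (integral-ℕ h)))
    where
    lemma : ∀ x y → x + y + (- ½ + - 2ℚ) ≡ - (2ℚ + ½) + 1ℚ * (x + y)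
    lemma = solve-∀ ℚ-ring
    lemma′ : ∀ x → 1ℚ + 2ℚ * x ≡ ½ * (1ℚ + 2ℚ * (2ℚ * x) - - 1ℚ)
    lemma′ = solve-∀ ℚ-ring

-- The case of odd `i` and even `n`.

-- For traces r, s the odd part of (1 + rX + X²)(1 + sX + X²) is (r + s)(X + X³).
e-pair : ∀ y z us j → e (reciprocal (y ∷ z ∷ withNegatives us)) (suc (double j)) ≡
  quad 1ℚ 1ℚ 0ℚ (K us) j * (trace y + trace z)
e-pair y z us j = begin
  e (reciprocal (y ∷ z ∷ withNegatives us)) (suc k)
    ≡⟨ e-reciprocal y (z ∷ withNegatives us) (suc k) ⟩
  quad 1ℚ r 1ℚ (e (reciprocal (z ∷ withNegatives us))) (suc k)
    ≡⟨ quad-cong 1ℚ r 1ℚ (e-reciprocal z (withNegatives us)) (suc k) ⟩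
  quad 1ℚ r 1ℚ (quad 1ℚ s 1ℚ c) (suc k)
    ≡⟨ quad-∘ 1ℚ r 1ℚ 1ℚ s 1ℚ c (suc k) ⟩
  poly (c (suc k)) (c k) (shift c k) (shift (shift c) k) (shift (shift (shift c)) k)
    ≡⟨ cong₂ (λ c₀ f → f c₀) (odd′ j) (cong₂ (λ c₁ f c₀ → f c₀ c₁) (even j)
        (cong₂ (λ c₂ f c₀ c₁ → f c₀ c₁ c₂) (shift-double odd′ j)
        (cong₂ (λ c₃ c₄ c₀ c₁ c₂ → poly c₀ c₁ c₂ c₃ c₄) (shift²-double even j)
          (shift-double (shift²-1+double {d = K us} odd′) j)))) ⟩
  poly 0ℚ (K us j) 0ℚ (shift (K us) j) 0ℚ ≡⟨ lemma r s (K us j) (shift (K us) j) (shift (shift (K us)) j) ⟩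
  quad 1ℚ 1ℚ 0ℚ (K us) j * (r + s) ∎
  where
  open ≡-Reasoning
  k = double j
  c = e (evens us)
  r = trace y
  s = trace z
  odd′ = e-evens-1+double us
  even = e-evens-double us
  poly : ℚ → ℚ → ℚ → ℚ → ℚ → ℚ
  poly c₀ c₁ c₂ c₃ c₄ = 1ℚ * 1ℚ * c₀ + (1ℚ * s + r * 1ℚ) * c₁ + (1ℚ * 1ℚ + r * s + 1ℚ * 1ℚ) * c₂
    + (r * 1ℚ + 1ℚ * s) * c₃ + 1ℚ * 1ℚ * c₄
  lemma : ∀ r s c₁ c₃ k₂ → 1ℚ * 1ℚ * 0ℚ + (1ℚ * s + r * 1ℚ) * c₁ + (1ℚ * 1ℚ + r * s + 1ℚ * 1ℚ) * 0ℚ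
    + (r * 1ℚ + 1ℚ * s) * c₃ + 1ℚ * 1ℚ * 0ℚ ≡ (1ℚ * c₁ + 1ℚ * c₃ + 0ℚ * k₂) * (r + s)
  lemma = solve-∀ ℚ-ring

nonzero-many-odd-even : ∀ j m → j ℕ.≤ m → NonzeroManySolutions (suc (double j)) (double (suc m))
nonzero-many-odd-even j m j≤m =
  -- At index j + 1 these weights give K(j) + K(j - 1), the factor `q` in the value `q * t`.
  let us , len , nz = K-nonvanishing ((0ℚ , 1ℚ , 1ℚ) ∷ []) ((λ ()) ∷ []) j≤m
      q             = quad 1ℚ 1ℚ 0ℚ (K us) j
      q≢0           = All.head nz ∘ trans (lemma (K us (suc j)) (K us j) (shift (K us) j) (shift (shift (K us)) j))
  in nonzero-many i n (λ { (t , pt , refl) → many us len pt })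
       (infinite-affine 0ℚ q≢0 infinite-points)
  where
  i n : ℕ
  i = suc (double j)
  n = double (suc m)
  lemma : ∀ c₀ c₁ c₂ c₃ → 0ℚ * c₀ + 1ℚ * c₁ + 1ℚ * c₂ ≡ 1ℚ * c₁ + 1ℚ * c₂ + 0ℚ * c₃
  lemma = solve-∀ ℚ-ring
  i≤2n : i ℕ.≤ double n
  i≤2n = s≤s (ℕ.≤-trans (double-mono j≤m) (ℕ.≤-trans (n≤double (double m)) (ℕ.m≤n+m _ 3)))
  many : ∀ us → length us ≡ m → ∀ {t} → Point t 0 → ManySolutions i n (0ℚ + quad 1ℚ 1ℚ 0ℚ (K us) j * t)
  many us len pt = infinite-image {S = ≡.setoid ℕ} {P = 0 ℕ.<_} {S′ = ≡.setoid (List ℚ)} (≡-dec _≟_)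
    {IsSolution i n _} (λ k _ → reciprocal (roots k)) (_∷ [])
    -- The first entry has 2-adic valuation -(k + 1), which recovers `k`; hence the iterated doubles
    -- are pairwise distinct.
    (λ {k} {l} _ _ eq → here (ℕ.suc-injective (valuation-unique (val (y l)) (suc l) (suc k) (η-odd l)
      (subst (λ x → Odd (x * 2^ suc k)) (∷-injectiveˡ eq) (η-odd k)))))
    (λ {k} _ → reciprocal-solution (roots k) (cong (suc ∘ suc) (trans (length-withNegatives us) (cong double len)))
      i≤2n (trans (e-pair (y k) (z k) us j) (trans (cong (quad 1ℚ 1ℚ 0ℚ (K us) j *_) (on-curve k)) (sym (+-identityˡ _)))))
    (infinite-ℕ 0)
    where
    module _ (k : ℕ) where
      open Point (iterate pt k) public
    roots : ℕ → List Unit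
    roots k = y k ∷ z k ∷ withNegatives us

-- Case distinction by the parities of `i` and `n`.

parity : ∀ n → ∃[ m ] (n ≡ double m ⊎ n ≡ suc (double m))
parity zero    = 0 , inj₁ refl
parity (suc n) with parity n
... | m , inj₁ refl = m , inj₂ refl
... | m , inj₂ refl = suc m , inj₁ refl

double-cancel-≤ : ∀ {m n} → double m ℕ.≤ suc (double n) → m ℕ.≤ n
double-cancel-≤ {zero}          _             = z≤n
double-cancel-≤ {suc m} {suc n} (s≤s (s≤s h)) = s≤s (double-cancel-≤ h)
double-cancel-≤ {suc m} {zero}  (s≤s ())

nonzero-many-solutions : ∀ i n → 1 ℕ.≤ i → i ℕ.≤ n → 2 ℕ.≤ n → NonzeroManySolutions i n
nonzero-many-solutions i n 1≤i i≤n 2≤n with parity i | parity n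
... | zero        , inj₁ refl | _ = ⊥-elim (ℕ.<⇒≱ (s≤s z≤n) 1≤i)
... | _           , _         | zero , inj₁ refl = ⊥-elim (ℕ.<⇒≱ (s≤s z≤n) 2≤n)
... | _           , _         | zero , inj₂ refl = ⊥-elim (ℕ.<⇒≱ (s≤s (s≤s z≤n)) 2≤n)
... | suc j       , inj₁ refl | suc m , inj₁ refl =
  EvenEven.nonzero-many-even-even j m (ℕ.s≤s⁻¹ (double-cancel-≤ (ℕ.m≤n⇒m≤1+n i≤n)))
... | suc j       , inj₁ refl | suc m , inj₂ refl = nonzero-many-even-odd j m (ℕ.s≤s⁻¹ (double-cancel-≤ i≤n))
... | j           , inj₂ refl | suc m , inj₁ refl = nonzero-many-odd-even j m (double-cancel-≤ (ℕ.s≤s⁻¹ i≤n))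
... | zero        , inj₂ refl | suc m , inj₂ refl = nonzero-many-1-odd m
... | suc j       , inj₂ refl | suc m , inj₂ refl =
  nonzero-many-odd-odd j m (ℕ.s≤s⁻¹ (double-cancel-≤ (ℕ.m≤n⇒m≤1+n (ℕ.s≤s⁻¹ i≤n))))
theorem2p2 : ∀ (i n : ℕ) → 1 ≤ i → i ≤ n → 2 ≤ n →
    let F = HeytingField.heytingCommutativeRing (RationalFunctionField (n ∸ 2))
        R = HeytingCommutativeRing.commutativeRing F
        open CommutativeRing R
        open ElementarySymmetric R
    in Infinite setoid (λ a → a ≉ 0# ×
         Infinite (≋-setoid setoid (2 *ℕ n)) (λ x →
           σ i x ≈ a × σ (2 *ℕ n ∸ i) x ≈ a × σ (2 *ℕ n) x ≈ 1#))
theorem2p2 i n 1≤i i≤n 2≤n = transfer-from-ℚ i n (nonzero-many-solutions i n 1≤i i≤n 2≤n)
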